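{- Let $p$ be a prime and let $\alpha \in \mathbb{Q}_p$ be quadratic over $\mathbb{Q}$ (i.e. algebraic over $\mathbb{Q}$ of degree exactly two). Then for each of Algorithms A, B and C, the continued fraction expansion of $\alpha$ obtained by that algorithm is eventually periodic.
   Context: Let $p$ be a prime, $v_p$ the $p$-adic additive valuation and $|\alpha|_p = p^{ -v_p(\alpha)}$. Each $\alpha\in\mathbb{Q}_p$ has a unique $p$-adic expansion $\alpha=\sum_{i} e_i p^i$ with $e_i\in\{0,1,\dots,p-1\}$ and $e_i\ne 0$ for at most finitely many $i\le 0$; put $[\alpha]=\sum_{i\le 0} e_i p^i$ and $\langle\alpha\rangle=\sum_{i\ge 1}e_ip^i$, so $\alpha=[\alpha]+\langle\alpha\rangle$. Let $A_p$ be the set of elements of $p\mathbb{Z}_p$ that are algebraic over $\mathbb{Q}$ of degree at most two. The minimal polynomial of an algebraic element is its integral polynomial of lowest degree with positive leading coefficient and coprime coefficients. For $x\in A_p$ write it as $aX^2+bX+c$ if $x$ is quadratic and as $bX+c$ if $x$ is rational. For $x\in A_p\setminus\{0\}$ put $u(x)=c|c|_p\in\mathbb{Z}\setminus p\mathbb{Z}$, and define maps $T_1,T_2:A_p\setminus\{0\}\to A_p$ by $$T_1(x)=\frac{u(x)p^{v_p(x)}}{x}-d_1(x),\qquad T_2(x)=\frac{ -u(x)p^{v_p(x)}}{x}-d_2(x),$$ where $d_1(x),d_2(x)\in\{1,\dots,p-1\}$ are the unique choices making $T_1(x),T_2(x)\in p\mathbb{Z}_p$. The three algorithms are given by the following maps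 $T:A_p\setminus\{0\}\to A_p$ (where the minimal polynomial of $x$ is $aX^2+bX+c$ if $x$ is quadratic and $bX+c$ if $x$ is rational). Algorithm A: $T(x)=T_2(x)$. Algorithm B: $T(x)=T_2(x)$ if $b\ge 0$, and $T(x)=T_1(x)$ if $b<0$. Algorithm C: $T(x)=T_2(x)$ if $b\ge 0$ and $c>0$, and $T(x)=T_1(x)$ otherwise. For a given algorithm put $t(x)=u(x)$, $d(x)=d_1(x)$ when $T(x)$ is defined as $T_1(x)$, and $t(x)=-u(x)$, $d(x)=d_2(x)$ when $T(x)$ is defined as $T_2(x)$; thus $T(x)=t(x)p^{v_p(x)}/x-d(x)$. The expansion of $\alpha\in\mathbb{Q}_p$ (algebraic of degree at most two) by the algorithm is the continued fraction $$[\alpha]+\cfrac{t_1p^{k_1}}{d_1+\cfrac{t_2p^{k_2}}{d_2+\cfrac{t_3p^{k_3}}{\ddots}}},\qquad t_i=t(T^{i-1}(\langle\alpha\rangle)),\ k_i=v_p(T^{i-1}(\langle\alpha\rangle)),\ d_i=d(T^{i-1}(\langle\alpha\rangle)),$$ which terminates after the $N$-th term if $T^N(\langle\alpha\rangle)=0$ for some (first) $N\ge 0$ (for $N=0$ it is just $[\alpha]$), and is infinite otherwise. The expansion is eventually periodic if it is infinite and there are $\ell\ge1$ and $M\ge1$ with $(t_{i+\ell},k_{i+\ell},d_{i+\ell})=(t_i,k_i,d_i)$ for all $i\ge M$. -}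

module Defs where

open import Data.Bool.Base using (if_then_else_; _∧_)
open import Data.Integer.Base as ℤ using (ℤ; +_; -[1+_]; 0ℤ; 1ℤ)
open import Data.Integer.DivMod using (_%ℕ_)
open import Data.Integer.Divisibility.Signed using (_∣_; divides; ∣m∣n⇒∣m+n; ∣n⇒∣m*n; ∣m⇒∣m*n; ∣m⇒∣-m)
import Data.Integer.Properties as ℤ
open import Data.Integer.Tactic.RingSolver using (solve-∀)
open import Data.Nat.Base as ℕ using (ℕ; zero; suc; NonZero)
import Data.Nat.Properties as ℕ
open import Data.Nat.Primality using (Prime; prime⇒nonZero)
open import Data.Product.Base using (∃; ∃-syntax; Σ-syntax; _×_)
open import Data.Vec.Base using (Vec; head; tail; last; foldr′)
open import Data.Vec.Relation.Unary.All using (All)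
open import Relation.Binary.PropositionalEquality using (_≡_; _≢_; subst)
open import Relation.Nullary using (¬_)
open import Relation.Nullary.Decidable.Core using (⌊_⌋)

data Algorithm : Set where
  A B C : Algorithm

data Branch : Set where
  use-T₁ use-T₂ : Branch

-- `branch alg b c`, where c and b are the coefficients of X⁰ and X¹ of the
-- minimal polynomial.
branch : Algorithm → ℤ → ℤ → Branch
branch A b c = use-T₂
branch B b c = if ⌊ 0ℤ ℤ.≤? b ⌋ then use-T₂ else use-T₁
branch C b c = if ⌊ 0ℤ ℤ.≤? b ⌋ ∧ ⌊ 0ℤ ℤ.<? c ⌋ then use-T₂ else use-T₁

signed : Branch → ℤ → ℤ
signed use-T₁ u = u
signed use-T₂ u = ℤ.- u

-- A partial numerator t pᵏ over a partial denominator d.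
record Term : Set where
  constructor term
  field
    t : ℤ
    k : ℤ
    d : ℕ

-- An integral polynomial of formal degree n is its coefficient vector, constant
-- coefficient first; the degree is exactly n when the last entry is nonzero.
Poly : ℕ → Set
Poly n = Vec ℤ (suc n)

Coprime : ∀ {n} → Poly n → Set
Coprime f = ∀ (m : ℕ) → All (+ m ∣_) f → m ≡ 1

module Padic (p : ℕ) (p-prime : Prime p) where

  private instance
    p≢0 : NonZero p
    p≢0 = prime⇒nonZero p-prime

  infix 8 p^_
  p^_ : ℕ → ℤ
  p^ n = + (p ℕ.^ n)

  -- ℤₚ = lim ℤ/pⁿ: `approx n` is an integer representing the class modulo pⁿ.
  record ℤₚ : Set where
    field
      approx   : ℕ → ℤ
      coherent : ∀ n → p^ n ∣ approx (suc n) ℤ.- approx n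
  open ℤₚ public

  infix 4 _≈ᶻ_
  _≈ᶻ_ : ℤₚ → ℤₚ → Set
  x ≈ᶻ y = ∀ n → p^ n ∣ approx x n ℤ.- approx y n

  fromℤ : ℤ → ℤₚ
  fromℤ z .approx   _ = z
  fromℤ z .coherent n = divides 0ℤ (ℤ.+-inverseʳ z)

  infixl 6 _+ᶻ_
  _+ᶻ_ : ℤₚ → ℤₚ → ℤₚ
  (x +ᶻ y) .approx   n = approx x n ℤ.+ approx y n
  (x +ᶻ y) .coherent n =
    subst (p^ n ∣_) (lemma (approx x (suc n)) (approx x n) (approx y (suc n)) (approx y n))
      (∣m∣n⇒∣m+n (coherent x n) (coherent y n))
    where
    lemma : ∀ a′ a b′ b → (a′ ℤ.- a) ℤ.+ (b′ ℤ.- b) ≡ (a′ ℤ.+ b′) ℤ.- (a ℤ.+ b)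
    lemma = solve-∀

  infix 8 -ᶻ_
  -ᶻ_ : ℤₚ → ℤₚ
  (-ᶻ x) .approx   n = ℤ.- approx x n
  (-ᶻ x) .coherent n =
    subst (p^ n ∣_) (lemma (approx x (suc n)) (approx x n)) (∣m⇒∣-m (coherent x n))
    where
    lemma : ∀ a′ a → ℤ.- (a′ ℤ.- a) ≡ ℤ.- a′ ℤ.- ℤ.- a
    lemma = solve-∀

  infixl 7 _*ᶻ_
  _*ᶻ_ : ℤₚ → ℤₚ → ℤₚ
  (x *ᶻ y) .approx   n = approx x n ℤ.* approx y n
  (x *ᶻ y) .coherent n =
    subst (p^ n ∣_) (lemma (approx x (suc n)) (approx x n) (approx y (suc n)) (approx y n))
      (∣m∣n⇒∣m+n (∣n⇒∣m*n (approx x (suc n)) (coherent y n))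
                 (∣m⇒∣m*n (approx y n) (coherent x n)))
    where
    lemma : ∀ a′ a b′ b → a′ ℤ.* (b′ ℤ.- b) ℤ.+ (a′ ℤ.- a) ℤ.* b ≡ a′ ℤ.* b′ ℤ.- a ℤ.* b
    lemma = solve-∀

  Unitᶻ : ℤₚ → Set
  Unitᶻ x = ¬ (+ p ∣ approx x 1)

  -- The coefficient eᵢ ∈ {0,…,p-1} in the p-adic expansion x = Σ eᵢ pⁱ.
  digit : ℤₚ → ℕ → ℕ
  digit x i = (approx x (suc i) %ℕ (p ℕ.^ suc i)) ℕ./ (p ℕ.^ i)
    where
    instance
      pⁱ≢0 : NonZero (p ℕ.^ i)
      pⁱ≢0 = ℕ.m^n≢0 p i
      pⁱ⁺¹≢0 : NonZero (p ℕ.^ suc i)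
      pⁱ⁺¹≢0 = ℕ.m^n≢0 p (suc i)

  -- Σ_{i<n} eᵢ pⁱ
  truncate : ℤₚ → ℕ → ℕ
  truncate x zero    = 0
  truncate x (suc n) = truncate x n ℕ.+ digit x n ℕ.* p ℕ.^ n

  -- ℚₚ = ℤₚ[1/p]: `x /p^ N` stands for x p⁻ᴺ.
  infix 5 _/p^_
  record ℚₚ : Set where
    constructor _/p^_
    field
      numerator : ℤₚ
      exponent  : ℕ
  open ℚₚ public

  infix 4 _≈_
  _≈_ : ℚₚ → ℚₚ → Set
  (x /p^ N) ≈ (y /p^ M) = fromℤ (p^ M) *ᶻ x ≈ᶻ fromℤ (p^ N) *ᶻ y

  ιᶻ : ℤₚ → ℚₚ
  ιᶻ x = x /p^ 0

  ι : ℤ → ℚₚ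
  ι z = ιᶻ (fromℤ z)

  infixl 6 _+_ _-_
  infixl 7 _*_
  infix  8 -_

  _+_ : ℚₚ → ℚₚ → ℚₚ
  (x /p^ N) + (y /p^ M) = (fromℤ (p^ M) *ᶻ x +ᶻ fromℤ (p^ N) *ᶻ y) /p^ (N ℕ.+ M)

  -_ : ℚₚ → ℚₚ
  - (x /p^ N) = (-ᶻ x) /p^ N

  _-_ : ℚₚ → ℚₚ → ℚₚ
  α - β = α + (- β)

  _*_ : ℚₚ → ℚₚ → ℚₚ
  (x /p^ N) * (y /p^ M) = (x *ᶻ y) /p^ (N ℕ.+ M)

  pPower : ℤ → ℚₚ
  pPower (+ n)    = ι (p^ n)
  pPower -[1+ n ] = fromℤ 1ℤ /p^ suc n

  HasValuation : ℚₚ → ℤ → Set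
  HasValuation α k = ∃[ w ] Unitᶻ w × α ≈ pPower k * ιᶻ w

  _∈pℤₚ : ℚₚ → Set
  α ∈pℤₚ = ∃[ z ] α ≈ ι (+ p) * ιᶻ z

  -- The digits of x p⁻ᴺ at exponents ≤ 0 are those of x at exponents 0,…,N.
  [_] : ℚₚ → ℚₚ
  [ x /p^ N ] = fromℤ (+ truncate x (suc N)) /p^ N

  ⟨_⟩ : ℚₚ → ℚₚ
  ⟨ α ⟩ = α - [ α ]

  eval : ∀ {n} → Poly n → ℚₚ → ℚₚ
  eval f α = foldr′ (λ c r → ι c + α * r) (ι 0ℤ) f

  record IsMinimalPolynomial {n : ℕ} (f : Poly n) (α : ℚₚ) : Set where
    field
      leading-positive : 0ℤ ℤ.< last f
      coprime          : Coprime f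
      root             : eval f α ≈ ι 0ℤ
      least-degree     : ∀ {m} (g : Poly m) → last g ≢ 0ℤ → eval g α ≈ ι 0ℤ → n ℕ.≤ m

  IsQuadratic : ℚₚ → Set
  IsQuadratic α = Σ[ f ∈ Poly 2 ] IsMinimalPolynomial f α

  -- Every element of ℚₚ has minimal polynomial of degree at least 1, if any, so
  -- degree at most two is degree 1 + e with e ≤ 1.
  record _∈Aₚ (x : ℚₚ) : Set where
    field
      {e}     : ℕ
      e≤1     : e ℕ.≤ 1
      minPoly : Poly (suc e)
      minimal : IsMinimalPolynomial minPoly x
      x∈pℤₚ   : x ∈pℤₚ

    c b : ℤ
    c = head minPoly
    b = head (tail minPoly)

  -- u = c |c|ₚ, for c ≠ 0
  IsPrimeToPPart : ℤ → ℤ → Set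
  IsPrimeToPPart c u = ¬ (+ p ∣ u) × ∃[ m ] c ≡ u ℤ.* p^ m

  -- The graph of T on Aₚ ∖ {0}: `Step alg x (term t k d) y` says that
  -- t = t(x), k = vₚ(x), d = d(x) and y = T(x) = t pᵏ / x - d.  The quotient is
  -- expressed by multiplying through by x, which is nonzero since it has a valuation.
  record Step (alg : Algorithm) (x : ℚₚ) (s : Term) (y : ℚₚ) : Set where
    open Term s
    field
      x∈Aₚ : x ∈Aₚ
    open _∈Aₚ x∈Aₚ using (b; c)
    field
      u         : ℤ
      u-def     : IsPrimeToPPart c u
      t-def     : t ≡ signed (branch alg b c) u
      valuation : HasValuation x k
      1≤d       : 1 ℕ.≤ d
      d<p       : d ℕ.< p
      y∈pℤₚ     : y ∈pℤₚ
      y-def     : (y + ι (+ d)) * x ≈ ι t * pPower k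

  -- The case where the expansion of α does not terminate.  The integral part is
  -- [ α ]; `orbit i` is Tⁱ(⟨α⟩), and `terms i` is the term numbered i + 1, i.e. the
  -- numbering starts at 0 rather than 1.  As T is a function, the terms are unique.
  record InfiniteExpansion (alg : Algorithm) (α : ℚₚ) : Set where
    field
      orbit : ℕ → ℚₚ
      terms : ℕ → Term
      start : orbit 0 ≈ ⟨ α ⟩
      steps : ∀ i → Step alg (orbit i) (terms i) (orbit (suc i))

  HasEventuallyPeriodicExpansion : Algorithm → ℚₚ → Set
  HasEventuallyPeriodicExpansion alg α =
    Σ[ E ∈ InfiniteExpansion alg α ] (let open InfiniteExpansion E in
      ∃[ ℓ ] ∃[ M ] 1 ℕ.≤ ℓ × (∀ i → M ℕ.≤ i → terms (i ℕ.+ ℓ) ≡ terms i))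

{-# OPTIONS --safe #-}
module Submission where

-- Write D = b² - 4ac for the discriminant of the minimal polynomial aX² + bX + c of
-- x, put k = vₚ(x), vₚ(c) = j + k and μ = min(j, k).  One step of any of the algorithms
-- divides D by p^2μ, and μ ≥ 1 when p ∣ b; as D is a nonzero integer, a polynomial
-- with p ∤ b is eventually reached.  From one step later on a = 1, p ∤ b and D
-- is constant, and x is the only root in pℤₚ, so that b alone determines the rest of
-- the expansion; explicitly b ↦ 2d + εb with p ∣ d + εb, where ε = ±1.  In Algorithm A
-- applying this twice gives b back; in Algorithms B and C |b| stays bounded, so some
-- b recurs.

open import Defs
open import Data.Fin.Base as Fin using (Fin; toℕ; fromℕ<; combine)
import Data.Fin.Properties as Fin
open import Data.Integer.Base as ℤ using (ℤ; +_; -[1+_]; 0ℤ; 1ℤ; _+_; _-_; _*_; -_)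
open import Data.Integer.DivMod using (_%ℕ_; _/ℕ_; a≡a%ℕn+[a/ℕn]*n; n%ℕd<d)
open import Data.Integer.Divisibility.Signed
import Data.Integer.Properties as ℤ
open import Data.Integer.Tactic.RingSolver using (solve-∀)
open import Data.Nat.Base as ℕ using (ℕ; zero; suc; NonZero; s≤s; z≤n)
import Data.Nat.Coprimality as ℕC
import Data.Nat.Divisibility as ℕ∣
import Data.Nat.DivMod as ℕ
open import Data.Nat.GCD using (gcd; gcd-greatest; gcd[m,n]∣m; gcd[m,n]∣n)
open import Data.Nat.Induction using (<-wellFounded)
import Data.Nat.Properties as ℕ
open import Data.Nat.Primality
  using (Prime; prime⇒nonZero; prime⇒nonTrivial; prime⇒irreducible; euclidsLemma)
open import Data.Nat.Tactic.RingSolver using () renaming (solve-∀ to ℕ-solve-∀)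
open import Data.Product.Base using (∃₂; ∃-syntax; Σ-syntax; _×_; _,_; proj₁; proj₂)
import Data.Sign.Base as Sign
open import Data.Sum.Base using (_⊎_; inj₁; inj₂; [_,_]′)
open import Data.Vec.Base using ([]; _∷_)
open import Data.Vec.Relation.Unary.All using ([]; _∷_)
open import Function.Base using (_∘_; id)
open import Induction.WellFounded using (Acc; acc)
open import Relation.Binary.PropositionalEquality
open import Relation.Nullary using (¬_; yes; no; contradiction)
open import Relation.Nullary.Decidable using (decidable-stable)

-- An element of ℤₚ is a sequence of approximations, so its equality is undecidable, and neither
-- valuations nor inverses come for free. Both are drawn from the polynomial. Since x (ax + b) = -c,
-- the valuation of `x` is at most that of the nonzero integer `c`, so one sufficiently precise
-- approximation of `x` reveals it; and the same relation gives u pᵏ / x = -(ax + b) / pʲ, where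
-- only a power of `p` is divided out. Recurrence, too, is shown on integers: in the range where a =
-- 1 and p ∤ b, `d` is the residue of -εb modulo `p`, while `u` and `k` are read off c = u pᵏ. Two
-- orbit points with the same coefficients thus have the same terms, without a proof that the points
-- themselves are equal.

∣-resp : ∀ {k i j} → i ≡ j → k ∣ i → k ∣ j
∣-resp {k} = subst (k ∣_)

m∣i-i%m : ∀ i m .{{_ : NonZero m}} → + m ∣ i - + (i %ℕ m)
m∣i-i%m i m = divides (i /ℕ m)
  (trans (cong (_- + (i %ℕ m)) (a≡a%ℕn+[a/ℕn]*n i m)) (lemma (+ (i %ℕ m)) (i /ℕ m * + m)))
  where
  lemma : ∀ r s → r + s - r ≡ s
  lemma = solve-∀

residue-unique : ∀ {m d e} → d ℕ.< m → e ℕ.< m → + m ∣ + d - + e → d ≡ e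
residue-unique {m} {d} {e} d<m e<m m∣d-e = ℤ.+-injective (ℤ.i-j≡0⇒i≡j (+ d) (+ e)
  (ℤ.∣i∣≡0⇒i≡0 (zero-of-small ℤ.∣ + d - + e ∣ small (∣⇒∣ᵤ m∣d-e))))
  where
  small : ℤ.∣ + d - + e ∣ ℕ.< m
  small = ℕ.≤-<-trans (subst (λ z → ℤ.∣ z ∣ ℕ.≤ d ℕ.⊔ e) (sym (ℤ.m-n≡m⊖n d e)) (ℤ.∣m⊝n∣≤m⊔n d e))
    (ℕ.⊔-lub d<m e<m)
  zero-of-small : ∀ n → n ℕ.< m → m ℕ∣.∣ n → n ≡ 0
  zero-of-small zero    _   _   = refl
  zero-of-small (suc n) n<m m∣n = contradiction m∣n (ℕ∣.>⇒∤ n<m)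

module Expansion (p : ℕ) (p-prime : Prime p) where

  open Padic p p-prime hiding (_+_; _-_; _*_; -_)

  private instance
    p≢0 : NonZero p
    p≢0 = prime⇒nonZero p-prime

  -- Powers of p dividing integers

  1<p : 1 ℕ.< p
  1<p = ℕ.nonTrivial⇒n>1 p {{prime⇒nonTrivial p-prime}}

  p^≢0 : ∀ n → ℤ.NonZero (p^ n)
  p^≢0 n = ℕ.m^n≢0 p n

  p^-suc : ∀ n → p^ suc n ≡ + p * p^ n
  p^-suc n = ℤ.pos-* p (p ℕ.^ n)

  p^-+ : ∀ m n → p^ (m ℕ.+ n) ≡ p^ m * p^ n
  p^-+ m n = trans (cong +_ (ℕ.^-distribˡ-+-* p m n)) (ℤ.pos-* (p ℕ.^ m) (p ℕ.^ n))

  p^-one : p^ 1 ≡ + p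
  p^-one = cong +_ (ℕ.*-identityʳ p)

  p^1∣⇒p∣ : ∀ {z} → p^ 1 ∣ z → + p ∣ z
  p^1∣⇒p∣ {z} = subst (_∣ z) p^-one

  p∣⇒p^1∣ : ∀ {z} → + p ∣ z → p^ 1 ∣ z
  p∣⇒p^1∣ {z} = subst (_∣ z) (sym p^-one)

  p^-mono-∣ : ∀ {m n} → m ℕ.≤ n → p^ m ∣ p^ n
  p^-mono-∣ {m} {n} m≤n = divides (p^ (n ℕ.∸ m))
    (trans (cong p^_ (sym (ℕ.m∸n+n≡m m≤n))) (p^-+ (n ℕ.∸ m) m))

  p^-cancel : ∀ m n {z} → p^ (m ℕ.+ n) ∣ p^ n * z → p^ m ∣ z
  p^-cancel m n h = *-cancelˡ-∣ (p^ n) {{p^≢0 n}}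
    (subst (_∣ _) (trans (p^-+ m n) (ℤ.*-comm (p^ m) (p^ n))) h)

  p∣∧p^∣⇒p^suc∣* : ∀ n {a b} → + p ∣ a → p^ n ∣ b → p^ suc n ∣ a * b
  p∣∧p^∣⇒p^suc∣* n {a} {b} p∣a p^∣b = subst (_∣ a * b) (sym (p^-suc n))
    (∣-trans (*-monoˡ-∣ (p^ n) p∣a) (*-monoʳ-∣ a p^∣b))

  p∣p^suc : ∀ n → + p ∣ p^ suc n
  p∣p^suc n = subst (_∣ p^ suc n) p^-one (p^-mono-∣ {1} {suc n} (s≤s z≤n))

  euclid : ∀ a b → + p ∣ a * b → (+ p ∣ a) ⊎ (+ p ∣ b)
  euclid a b h with euclidsLemma ℤ.∣ a ∣ ℤ.∣ b ∣ p-prime (subst (p ℕ∣.∣_) (ℤ.abs-* a b) (∣⇒∣ᵤ h))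
  ... | inj₁ h′ = inj₁ (∣ᵤ⇒∣ h′)
  ... | inj₂ h′ = inj₂ (∣ᵤ⇒∣ h′)

  p-cancel : ∀ q b e → p^ suc e ∣ q * + p * b → p^ e ∣ q * b
  p-cancel q b e h = *-cancelˡ-∣ (+ p) (subst₂ _∣_ (p^-suc e) (lemma q (+ p) b) h)
    where
    lemma : ∀ q r b → q * r * b ≡ r * (q * b)
    lemma = solve-∀

  p-monoˡ : ∀ q e → p^ e ∣ q → p^ suc e ∣ q * + p
  p-monoˡ q e h = subst₂ _∣_ (sym (p^-suc e)) (ℤ.*-comm (+ p) q) (*-monoʳ-∣ (+ p) h)

  p^-cancel-unit : ∀ n a b → p^ n ∣ b * a → ¬ (+ p ∣ a) → p^ n ∣ b
  p^-cancel-unit zero    a b h p∤a = divides b (sym (ℤ.*-identityʳ b))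
  p^-cancel-unit (suc n) a b h p∤a with euclid b a (∣-trans (p∣p^suc n) h)
  ... | inj₂ p∣a              = contradiction p∣a p∤a
  ... | inj₁ (divides q refl) = p-monoˡ q n (p^-cancel-unit n a q (p-cancel q a n h) p∤a)

  -- A finite-precision form of the absence of zero divisors: vₚ(a) < n leaves more than `m` of the
  -- n + m factors `p` for `b`. The recursion strips one `p` from `a` at a time.
  p^-cancel-factor : ∀ m n a b → p^ (n ℕ.+ m) ∣ a * b → ¬ (p^ n ∣ a) → p^ m ∣ b
  p^-cancel-factor m zero    a b h p^n∤a = contradiction (divides a (sym (ℤ.*-identityʳ a))) p^n∤a
  p^-cancel-factor m (suc n) a b h p^n∤a with + p ∣? a
  ... | yes (divides q refl) =
    p^-cancel-factor m n q b (p-cancel q b (n ℕ.+ m) h) (p^n∤a ∘ p-monoˡ q n)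
  ... | no p∤a =
    ∣-trans (p^-mono-∣ (ℕ.m≤n+m m (suc n)))
      (p^-cancel-unit (suc n ℕ.+ m) a b (∣-resp (ℤ.*-comm a b) h) p∤a)

  abstract
    prime-to-p-factorisation : ∀ c → c ≢ 0ℤ → ∃[ u ] IsPrimeToPPart c u
    prime-to-p-factorisation c = go c (<-wellFounded ℤ.∣ c ∣)
      where
      go : ∀ c → Acc ℕ._<_ ℤ.∣ c ∣ → c ≢ 0ℤ → ∃[ u ] IsPrimeToPPart c u
      go c (acc rec) c≢0 with + p ∣? c
      ... | no p∤c = c , p∤c , 0 , sym (ℤ.*-identityʳ c)
      ... | yes (divides q refl) with go q (rec smaller) q≢0
        where
        q≢0 : q ≢ 0ℤ
        q≢0 refl = c≢0 refl
        smaller : ℤ.∣ q ∣ ℕ.< ℤ.∣ q * + p ∣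
        smaller = subst (ℤ.∣ q ∣ ℕ.<_) (sym (ℤ.abs-* q (+ p)))
          (ℕ.m<m*n ℤ.∣ q ∣ p {{ℕ.≢-nonZero (q≢0 ∘ ℤ.∣i∣≡0⇒i≡0)}} 1<p)
      ...   | u , p∤u , m , q≡ = u , p∤u , suc m , trans (cong (_* + p) q≡)
        (trans (ℤ.*-assoc u (p^ m) (+ p)) (cong (u *_) (trans (ℤ.*-comm (p^ m) (+ p)) (sym (p^-suc m)))))

  prime-to-p-factorisation-unique : ∀ {u u′} k k′ → ¬ (+ p ∣ u) → ¬ (+ p ∣ u′) →
    u * p^ k ≡ u′ * p^ k′ → u ≡ u′ × k ≡ k′
  prime-to-p-factorisation-unique {u} {u′} zero    zero     p∤u p∤u′ eq =
    trans (sym (ℤ.*-identityʳ u)) (trans eq (ℤ.*-identityʳ u′)) , refl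
  prime-to-p-factorisation-unique {u} {u′} zero    (suc k′) p∤u p∤u′ eq =
    contradiction (∣-resp (trans (sym eq) (ℤ.*-identityʳ u)) (∣n⇒∣m*n u′ (p∣p^suc k′))) p∤u
  prime-to-p-factorisation-unique {u} {u′} (suc k) zero     p∤u p∤u′ eq =
    contradiction (∣-resp (trans eq (ℤ.*-identityʳ u′)) (∣n⇒∣m*n u (p∣p^suc k))) p∤u′
  prime-to-p-factorisation-unique {u} {u′} (suc k) (suc k′) p∤u p∤u′ eq
    with prime-to-p-factorisation-unique k k′ p∤u p∤u′
           (ℤ.*-cancelˡ-≡ (+ p) _ _ (trans (pull u k) (trans eq (sym (pull u′ k′)))))
    where
    lemma : ∀ r v s → r * (v * s) ≡ v * (r * s)
    lemma = solve-∀
    pull : ∀ v e → + p * (v * p^ e) ≡ v * p^ suc e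
    pull v e = trans (lemma (+ p) v (p^ e)) (cong (v *_) (sym (p^-suc e)))
  ... | u≡u′ , refl = u≡u′ , refl

  p^∣u*p^⇒≤ : ∀ {u} n k → ¬ (+ p ∣ u) → p^ n ∣ u * p^ k → n ℕ.≤ k
  p^∣u*p^⇒≤ {u} n k p∤u h with n ℕ.≤? k
  ... | yes n≤k = n≤k
  ... | no  n≰k = contradiction
    (subst (_∣ u) p^-one
      (p^-cancel 1 k (∣-trans (p^-mono-∣ (ℕ.≰⇒> n≰k)) (∣-resp (ℤ.*-comm u (p^ k)) h)))) p∤u

  p^∣-all⇒≡0 : ∀ z → (∀ n → p^ n ∣ z) → z ≡ 0ℤ
  p^∣-all⇒≡0 z h with z ℤ.≟ 0ℤ
  ... | yes z≡0 = z≡0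
  ... | no  z≢0 with prime-to-p-factorisation z z≢0
  ...   | u , p∤u , m , refl = contradiction (p^∣u*p^⇒≤ (suc m) m p∤u (h (suc m))) (ℕ.<-irrefl refl)

  p∤-coprime : ∀ e {v} m → ¬ (+ p ∣ v) → + m ∣ p^ e → + m ∣ v → m ≡ 1
  p∤-coprime e {v} m p∤v m∣p^e m∣v = go e (∣⇒∣ᵤ m∣p^e)
    where
    m⊥p : ℕC.Coprime m p
    m⊥p {d} (d∣m , d∣p) with prime⇒irreducible p-prime d∣p
    ... | inj₁ d≡1  = d≡1
    ... | inj₂ refl = contradiction (∣-trans (∣ᵤ⇒∣ d∣m) m∣v) p∤v
    go : ∀ e → m ℕ∣.∣ p ℕ.^ e → m ≡ 1
    go zero    h = ℕ∣.∣1⇒≡1 h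
    go (suc e) h = go e (ℕC.coprime-divisor m⊥p h)

  -- p-adic integers: change of precision, vanishing, division by powers of p

  coherent-≤ : ∀ (z : ℤₚ) {m n} → m ℕ.≤ n → p^ m ∣ approx z n - approx z m
  coherent-≤ z {m} m≤n = go (ℕ.≤⇒≤′ m≤n)
    where
    lemma : ∀ a b c → (a - b) + (b - c) ≡ a - c
    lemma = solve-∀
    go : ∀ {n} → m ℕ.≤′ n → p^ m ∣ approx z n - approx z m
    go (ℕ.≤′-reflexive refl) = divides 0ℤ (ℤ.+-inverseʳ (approx z m))
    go (ℕ.≤′-step {n} m≤′n) = ∣-resp (lemma (approx z (suc n)) (approx z n) (approx z m))
      (∣m∣n⇒∣m+n (∣-trans (p^-mono-∣ (ℕ.≤′⇒≤ m≤′n)) (coherent z n)) (go m≤′n))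

  -- With `lower`: divisibility by pᵏ does not depend on the level, from level `k` on, so each
  -- argument may choose its own precision.
  lift : ∀ (z : ℤₚ) {k m n} → k ℕ.≤ m → m ℕ.≤ n → p^ k ∣ approx z m → p^ k ∣ approx z n
  lift z {k} {m} {n} k≤m m≤n h = ∣-resp (lemma (approx z n) (approx z m))
    (∣m∣n⇒∣m+n (∣-trans (p^-mono-∣ k≤m) (coherent-≤ z m≤n)) h)
    where
    lemma : ∀ a b → (a - b) + b ≡ a
    lemma = solve-∀

  lower : ∀ (z : ℤₚ) {k m n} → k ℕ.≤ m → m ℕ.≤ n → p^ k ∣ approx z n → p^ k ∣ approx z m
  lower z {k} {m} {n} k≤m m≤n h = ∣-resp (lemma (approx z n) (approx z m))
    (∣m∣n⇒∣m-n h (∣-trans (p^-mono-∣ k≤m) (coherent-≤ z m≤n)))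
    where
    lemma : ∀ a b → a - (a - b) ≡ b
    lemma = solve-∀

  unit-lift : ∀ (z : ℤₚ) n → Unitᶻ z → ¬ (+ p ∣ approx z (suc n))
  unit-lift z n unit h = unit (p^1∣⇒p∣ (lower z {1} ℕ.≤-refl (s≤s z≤n) (p∣⇒p^1∣ h)))

  -- Equality with zero without the subtraction of zero, so that ring identities in the
  -- approximations apply directly.
  IsZero : ℤₚ → Set
  IsZero z = ∀ n → p^ n ∣ approx z n

  cancel-p^-IsZero : ∀ e z → IsZero (fromℤ (p^ e) *ᶻ z) → IsZero z
  cancel-p^-IsZero e z h n = lower z ℕ.≤-refl (ℕ.m≤m+n n e) (p^-cancel n e (h (n ℕ.+ e)))

  -- A negated `IsZero` supplies no explicit level at which `y` is nonzero. Divisibility at a fixed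
  -- level is decidable, however, so one may argue by contradiction there: a level `n` with pⁿ ∤ y
  -- forces every level of `z` to vanish.
  ¬IsZero-* : ∀ y z → ¬ IsZero y → ¬ IsZero z → ¬ IsZero (y *ᶻ z)
  ¬IsZero-* y z y≉0 z≉0 yz≈0 = y≉0 λ n → decidable-stable (p^ n ∣? approx y n) λ p^n∤y →
    z≉0 λ m → lower z ℕ.≤-refl (ℕ.m≤n+m m n)
      (p^-cancel-factor m n _ _ (yz≈0 (n ℕ.+ m))
        (p^n∤y ∘ lower y ℕ.≤-refl (ℕ.m≤m+n n m)))

  fromℤ-¬IsZero : ∀ {z} → z ≢ 0ℤ → ¬ IsZero (fromℤ z)
  fromℤ-¬IsZero z≢0 h = z≢0 (p^∣-all⇒≡0 _ h)

  module _ (e : ℕ) (z : ℤₚ) (p^e∣z : p^ e ∣ approx z e) where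

    private
      p^e∣z₊ : ∀ n → p^ e ∣ approx z (n ℕ.+ e)
      p^e∣z₊ n = lift z ℕ.≤-refl (ℕ.m≤n+m e n) p^e∣z

      exact : ∀ n → p^ e * _∣_.quotient (p^e∣z₊ n) ≡ approx z (n ℕ.+ e)
      exact n = trans (ℤ.*-comm (p^ e) _) (sym (_∣_.equality (p^e∣z₊ n)))

    -- Division by pᵉ costs `e` levels of precision: level `n` of the quotient is computed from
    -- level n + e of `z`.
    divide-p^ : ℤₚ
    divide-p^ .approx   n = _∣_.quotient (p^e∣z₊ n)
    divide-p^ .coherent n = p^-cancel n e
      (∣-resp (trans (cong₂ _-_ (sym (exact (suc n))) (sym (exact n))) (lemma (p^ e) _ _))
        (coherent z (n ℕ.+ e)))
      where
      lemma : ∀ r a b → r * a - r * b ≡ r * (a - b)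
      lemma = solve-∀

    divide-p^-≈ : fromℤ (p^ e) *ᶻ divide-p^ ≈ᶻ z
    divide-p^-≈ n = ∣-resp (cong (_- approx z n) (sym (exact n)))
      (coherent-≤ z (ℕ.m≤m+n n e))

  -- Quadratic elements of pℤₚ and the valuations of x, ax + b and c

  linear : ℤ → ℤ → ℤₚ → ℤₚ
  linear a b x = fromℤ a *ᶻ x +ᶻ fromℤ b

  quadratic : ℤ → ℤ → ℤ → ℤₚ → ℤₚ
  quadratic a b c x = fromℤ a *ᶻ (x *ᶻ x) +ᶻ fromℤ b *ᶻ x +ᶻ fromℤ c

  discriminant : ℤ → ℤ → ℤ → ℤ
  discriminant a b c = b * b - + 4 * (a * c)

  -- Minimality in the form that one step is shown to preserve: `irrational` excludes degree 1, and
  -- degree 0 is excluded by any nonzero constant being nonzero in ℤₚ.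
  record Quadratic (x : ℤₚ) (a b c : ℤ) : Set where
    field
      0<a        : 0ℤ ℤ.< a
      coprime    : Coprime (c ∷ b ∷ a ∷ [])
      root       : IsZero (quadratic a b c x)
      p∣x        : + p ∣ approx x 1
      irrational : ∀ g h → g ≢ 0ℤ → ¬ IsZero (linear g h x)

    a≢0 : a ≢ 0ℤ
    a≢0 refl = ℤ.<-irrefl refl 0<a

    p∣c : + p ∣ c
    p∣c = ∣m+n∣m⇒∣n (p^1∣⇒p∣ (root 1))
      (∣-resp (lemma a b (approx x 1)) (∣n⇒∣m*n (a * approx x 1 + b) p∣x))
      where
      lemma : ∀ a b x → (a * x + b) * x ≡ a * (x * x) + b * x
      lemma = solve-∀

    c≢0 : c ≢ 0ℤ
    -- For c = 0 the root would satisfy x (ax + b) = 0, with neither factor zero.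
    c≢0 refl = ¬IsZero-* x (linear a b x) x≉0 (irrational a b a≢0)
      λ n → ∣-resp (lemma a b (approx x n)) (root n)
      where
      x≉0 : ¬ IsZero x
      x≉0 h = irrational 1ℤ 0ℤ (λ ()) λ n → ∣-resp (identity (approx x n)) (h n)
        where
        identity : ∀ x → x ≡ 1ℤ * x + 0ℤ
        identity = solve-∀
      lemma : ∀ a b x → a * (x * x) + b * x + 0ℤ ≡ x * (a * x + b)
      lemma = solve-∀

    -- 4a (ax² + bx + c) = (2ax + b)² - D
    discriminant≢0 : discriminant a b c ≢ 0ℤ
    discriminant≢0 D≡0 = ¬IsZero-* 2ax+b 2ax+b 2ax+b≉0 2ax+b≉0
      λ n → ∣-resp (lemma a b c (approx x n))
        (∣m∣n⇒∣m+n (∣n⇒∣m*n (+ 4 * a) (root n)) (∣-resp (sym D≡0) (divides 0ℤ refl)))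
      where
      2ax+b : ℤₚ
      2ax+b = linear (+ 2 * a) b x
      2ax+b≉0 : ¬ IsZero 2ax+b
      2ax+b≉0 = irrational (+ 2 * a) b λ 2a≡0 →
        [ (λ ()) , a≢0 ]′ (ℤ.i*j≡0⇒i≡0∨j≡0 (+ 2) 2a≡0)
      lemma : ∀ a b c x → + 4 * a * (a * (x * x) + b * x + c) + (b * b - + 4 * (a * c))
        ≡ (+ 2 * a * x + b) * (+ 2 * a * x + b)
      lemma = solve-∀

  -- x = pᵏ w, ax + b = pʲ q and c = u pʲ⁺ᵏ with w, q and u prime to p, and μ = min(j, k).
  record Factorisation (x : ℤₚ) (a b c : ℤ) : Set where
    field
      j k μ j′ k′ : ℕ
      u β     : ℤ
      w q     : ℤₚ
      1≤k     : 1 ℕ.≤ k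
      p∤u     : ¬ (+ p ∣ u)
      w-unit  : Unitᶻ w
      q-unit  : Unitᶻ q
      j≡      : j ≡ μ ℕ.+ j′
      k≡      : k ≡ μ ℕ.+ k′
      c≡      : c ≡ u * p^ (j ℕ.+ k)
      b≡      : b ≡ β * p^ μ
      x≈      : fromℤ (p^ k) *ᶻ w ≈ᶻ x
      q≈      : fromℤ (p^ j) *ᶻ q ≈ᶻ linear a b x
      q*x≈    : IsZero (q *ᶻ x +ᶻ fromℤ (u * p^ k))
      q-root  : IsZero (quadratic (p^ j) (- b) (a * (u * p^ k)) q)
      minimum : j′ ≡ 0 ⊎ (k′ ≡ 0 × ¬ (+ p ∣ a))

  factorise : ∀ {x a b c} → Quadratic x a b c → Factorisation x a b c
  factorise {x} {a} {b} {c} Q = by-minimum (ℕ.≤-total j k)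
    where
    open Quadratic Q
    c-factorisation : ∃[ u ] IsPrimeToPPart c u
    c-factorisation = prime-to-p-factorisation c c≢0
    u = proj₁ c-factorisation
    p∤u = proj₁ (proj₂ c-factorisation)
    m = proj₁ (proj₂ (proj₂ c-factorisation))
    c≡ = proj₂ (proj₂ (proj₂ c-factorisation))

    -- As c = u pᵐ, level m + 1 is the first at which `c` is nonzero. If `x` vanished at this level,
    -- so would c = -(ax + b) x. Hence vₚ(x) ≤ m, and `x̂` already determines it.
    x̂ = approx x (suc m)

    p^∤x̂ : ¬ (p^ suc m ∣ x̂)
    p^∤x̂ h = ℕ.<-irrefl refl (p^∣u*p^⇒≤ (suc m) m p∤u (∣-resp c≡
      (∣m+n∣m⇒∣n (root (suc m)) (∣-resp (lemma a b x̂) (∣n⇒∣m*n (a * x̂ + b) h)))))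
      where
      lemma : ∀ a b x → (a * x + b) * x ≡ a * (x * x) + b * x
      lemma = solve-∀

    x̂≢0 : x̂ ≢ 0ℤ
    x̂≢0 eq = p^∤x̂ (subst (p^ suc m ∣_) (sym eq) (divides 0ℤ refl))

    x̂-factorisation : ∃[ v ] IsPrimeToPPart x̂ v
    x̂-factorisation = prime-to-p-factorisation x̂ x̂≢0
    v = proj₁ x̂-factorisation
    p∤v = proj₁ (proj₂ x̂-factorisation)
    k = proj₁ (proj₂ (proj₂ x̂-factorisation))
    x̂≡ = proj₂ (proj₂ (proj₂ x̂-factorisation))

    p^k∣x̂ : p^ k ∣ x̂
    p^k∣x̂ = divides v x̂≡

    k≤m : k ℕ.≤ m
    k≤m = ℕ.≮⇒≥ λ m<k → p^∤x̂ (∣-trans (p^-mono-∣ m<k) p^k∣x̂)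

    p∣x₊ : ∀ n → p^ 1 ∣ approx x (suc n)
    p∣x₊ n = lift x ℕ.≤-refl (s≤s z≤n) (p∣⇒p^1∣ p∣x)

    1≤k : 1 ℕ.≤ k
    1≤k = p^∣u*p^⇒≤ 1 k p∤v (∣-resp x̂≡ (p∣x₊ m))

    p^k∣x : p^ k ∣ approx x k
    p^k∣x = lower x ℕ.≤-refl (ℕ.m≤n⇒m≤1+n k≤m) p^k∣x̂

    w : ℤₚ
    w = divide-p^ k x p^k∣x

    x≈ : fromℤ (p^ k) *ᶻ w ≈ᶻ x
    x≈ = divide-p^-≈ k x p^k∣x

    w-unit : Unitᶻ w
    w-unit h = ℕ.<-irrefl refl (p^∣u*p^⇒≤ (suc k) k p∤v (∣-resp x̂≡
      (lift x ℕ.≤-refl (s≤s k≤m) p^∣x)))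
      where
      p∣w : + p ∣ approx w (suc k)
      p∣w = p^1∣⇒p∣ (lift w {1} ℕ.≤-refl (s≤s z≤n) (p∣⇒p^1∣ h))
      p^∣p^*w : p^ suc k ∣ p^ k * approx w (suc k)
      p^∣p^*w = ∣-resp (ℤ.*-comm (approx w (suc k)) (p^ k)) (p∣∧p^∣⇒p^suc∣* k p∣w ∣-refl)
      lemma : ∀ r s → r - (r - s) ≡ s
      lemma = solve-∀
      p^∣x : p^ suc k ∣ approx x (suc k)
      p^∣x = ∣-resp (lemma (p^ k * approx w (suc k)) (approx x (suc k)))
        (∣m∣n⇒∣m-n p^∣p^*w (x≈ (suc k)))

    j = m ℕ.∸ k

    m≡ : m ≡ j ℕ.+ k
    m≡ = sym (ℕ.m∸n+n≡m k≤m)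

    L : ℤₚ
    L = linear a b x

    p^j∣L : p^ j ∣ approx L j
    -- Modulo pᵐ the root equation reads pᵏ v (ax + b) ≡ 0; cancel pᵏ and then the unit `v`.
    p^j∣L = lower L ℕ.≤-refl (ℕ.m≤n⇒m≤1+n (ℕ.m∸n≤m m k))
      (p^-cancel-unit j v (approx L (suc m)) (p^-cancel j k p^m∣) p∤v)
      where
      lemma : ∀ a b c v r → a * (v * r * (v * r)) + b * (v * r) + c
        ≡ r * ((a * (v * r) + b) * v) + c
      lemma = solve-∀
      p^m∣ : p^ (j ℕ.+ k) ∣ p^ k * (approx L (suc m) * v)
      p^m∣ = subst (λ e → p^ e ∣ p^ k * (approx L (suc m) * v)) m≡
        (∣m+n∣n⇒∣m
          (∣-resp (trans (cong (λ y → a * (y * y) + b * y + c) x̂≡)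
                    (trans (lemma a b c v (p^ k))
                      (cong (λ y → p^ k * ((a * y + b) * v) + c) (sym x̂≡))))
            (∣-trans (p^-mono-∣ (ℕ.n≤1+n m)) (root (suc m))))
          (divides u c≡))

    q : ℤₚ
    q = divide-p^ j L p^j∣L

    q≈ : fromℤ (p^ j) *ᶻ q ≈ᶻ L
    q≈ = divide-p^-≈ j L p^j∣L

    c≡′ : c ≡ u * p^ (j ℕ.+ k)
    c≡′ = trans c≡ (cong (λ e → u * p^ e) m≡)

    -- The relation (ax + b) x = -c divided by pʲ.
    q*x≈ : IsZero (q *ᶻ x +ᶻ fromℤ (u * p^ k))
    q*x≈ = cancel-p^-IsZero j (q *ᶻ x +ᶻ fromℤ (u * p^ k)) λ n →
      let q′ = approx q n ; x′ = approx x n in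
      ∣-resp
        (trans (cong (λ c → (p^ j * q′ - (a * x′ + b)) * x′ + (a * (x′ * x′) + b * x′ + c))
                 (trans c≡′ (cong (u *_) (p^-+ j k))))
               (lemma (p^ j) q′ a b x′ u (p^ k)))
        (∣m∣n⇒∣m+n (∣m⇒∣m*n x′ (q≈ n)) (root n))
      where
      lemma : ∀ r q a b x u s → (r * q - (a * x + b)) * x + (a * (x * x) + b * x + u * (r * s))
        ≡ r * (q * x + u * s)
      lemma = solve-∀

    -- Multiply pʲ q = ax + b by `q` and replace qx by -u pᵏ.
    q-root : IsZero (quadratic (p^ j) (- b) (a * (u * p^ k)) q)
    q-root n = ∣-resp (lemma (p^ j) (approx q n) a b (approx x n) (u * p^ k))
      (∣m∣n⇒∣m+n (∣m⇒∣m*n (approx q n) (q≈ n)) (∣n⇒∣m*n a (q*x≈ n)))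
      where
      lemma : ∀ r q a b x v → (r * q - (a * x + b)) * q + a * (q * x + v)
        ≡ r * (q * q) + - b * q + a * v
      lemma = solve-∀

    q-unit : Unitᶻ q
    -- If p ∣ q, then p^(k+1) divides qx = -u pᵏ, although p ∤ u.
    q-unit h = ℕ.<-irrefl refl (p^∣u*p^⇒≤ (suc k) k p∤u (∣m+n∣m⇒∣n (q*x≈ (suc k))
      (p∣∧p^∣⇒p^suc∣* k p∣q (lift x ℕ.≤-refl (ℕ.n≤1+n k) p^k∣x))))
      where
      p∣q : + p ∣ approx q (suc k)
      p∣q = p^1∣⇒p∣ (lift q {1} ℕ.≤-refl (s≤s z≤n) (p∣⇒p^1∣ h))

    p^∣b : ∀ μ → μ ℕ.≤ j → μ ℕ.≤ k → p^ μ ∣ b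
    -- In pʲ q² - bq + a u pᵏ = 0 the outer terms are divisible by p^μ, hence so is bq, and `q` is a
    -- unit.
    p^∣b μ μ≤j μ≤k = p^-cancel-unit μ q̂ b
      (∣-resp (lemma (p^ j) q̂ b (a * (u * p^ k)))
        (∣m∣n⇒∣m-n
          (∣m∣n⇒∣m+n (∣m⇒∣m*n (q̂ * q̂) (p^-mono-∣ μ≤j)) (∣n⇒∣m*n a (∣n⇒∣m*n u (p^-mono-∣ μ≤k))))
          (∣-trans (p^-mono-∣ (ℕ.n≤1+n μ)) (q-root (suc μ)))))
      (unit-lift q μ q-unit)
      where
      q̂ = approx q (suc μ)
      lemma : ∀ r q b v → (r * (q * q) + v) - (r * (q * q) + - b * q + v) ≡ b * q
      lemma = solve-∀

    split : ∀ μ j′ k′ → j ≡ μ ℕ.+ j′ → k ≡ μ ℕ.+ k′ → j′ ≡ 0 ⊎ (k′ ≡ 0 × ¬ (+ p ∣ a)) →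
      Factorisation x a b c
    split μ j′ k′ j≡ k≡ minimum = record
      { j = j ; k = k ; μ = μ ; j′ = j′ ; k′ = k′ ; u = u ; β = _∣_.quotient p^μ∣b ; w = w ; q = q
      ; 1≤k = 1≤k ; p∤u = p∤u ; w-unit = w-unit ; q-unit = q-unit
      ; j≡ = j≡ ; k≡ = k≡ ; c≡ = c≡′ ; b≡ = _∣_.equality p^μ∣b ; x≈ = x≈ ; q≈ = q≈ ; q*x≈ = q*x≈ ; q-root = q-root
      ; minimum = minimum
      }
      where
      p^μ∣b : p^ μ ∣ b
      p^μ∣b = p^∣b μ (subst (μ ℕ.≤_) (sym j≡) (ℕ.m≤m+n μ j′)) (subst (μ ℕ.≤_) (sym k≡) (ℕ.m≤m+n μ k′))

    by-minimum : j ℕ.≤ k ⊎ k ℕ.≤ j → Factorisation x a b c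
    by-minimum (inj₁ j≤k) =
      split j 0 (k ℕ.∸ j) (sym (ℕ.+-identityʳ j)) (sym (ℕ.m+[n∸m]≡n j≤k)) (inj₁ refl)
    by-minimum (inj₂ k≤j) =
      split k (j ℕ.∸ k) 0 (sym (ℕ.m+[n∸m]≡n k≤j)) (sym (ℕ.+-identityʳ k))
        -- Here μ = k ≥ 1, so `p` divides both `b` and `c`, and coprimality keeps it from dividing
        -- `a`.
        (inj₂ (refl , λ p∣a → ℕ.<-irrefl (sym (coprime p (p∣c ∷ p∣b ∷ p∣a ∷ []))) 1<p))
      where
      p∣b : + p ∣ b
      p∣b = p^1∣⇒p∣ (∣-trans (p^-mono-∣ 1≤k) (p^∣b k k≤j ℕ.≤-refl))

  -- From `Quadratic` to membership in Aₚ

  ιᶻ-cong : ∀ {x y} → x ≈ᶻ y → ιᶻ x ≈ ιᶻ y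
  ιᶻ-cong {x} {y} h n = ∣-resp (lemma (approx x n) (approx y n)) (h n)
    where
    lemma : ∀ x y → x - y ≡ 1ℤ * x - 1ℤ * y
    lemma = solve-∀

  p∣⇒∈pℤₚ : ∀ x → + p ∣ approx x 1 → ιᶻ x ∈pℤₚ
  p∣⇒∈pℤₚ x p∣x = z , ιᶻ-cong {x} {fromℤ (+ p) *ᶻ z} λ n →
    ∣-resp (trans (lemma (p^ 1 * approx z n) (approx x n)) (cong (λ r → approx x n - r * approx z n) p^-one))
      (∣m⇒∣-m (divide-p^-≈ 1 x (p∣⇒p^1∣ p∣x) n))
    where
    z = divide-p^ 1 x (p∣⇒p^1∣ p∣x)
    lemma : ∀ r s → - (r - s) ≡ s - r
    lemma = solve-∀

  module _ {x a b c} (Q : Quadratic x a b c) where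
    open Quadratic Q

    isMinimalPolynomial : IsMinimalPolynomial (c ∷ b ∷ a ∷ []) (ιᶻ x)
    isMinimalPolynomial .IsMinimalPolynomial.leading-positive = 0<a
    isMinimalPolynomial .IsMinimalPolynomial.coprime          = coprime
    isMinimalPolynomial .IsMinimalPolynomial.root n           = ∣-resp (lemma a b c (approx x n)) (root n)
      where
      lemma : ∀ a b c x → a * (x * x) + b * x + c
        ≡ 1ℤ * (1ℤ * c + 1ℤ * (x * (1ℤ * b + 1ℤ * (x * (1ℤ * a + 1ℤ * (x * 0ℤ)))))) - 1ℤ * 0ℤ
      lemma = solve-∀
    isMinimalPolynomial .IsMinimalPolynomial.least-degree {0} (h ∷ []) h≢0 h≈0 =
      contradiction (λ n → ∣-resp (lemma h (approx x n)) (h≈0 n)) (fromℤ-¬IsZero h≢0)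
      where
      lemma : ∀ h x → 1ℤ * (1ℤ * h + 1ℤ * (x * 0ℤ)) - 1ℤ * 0ℤ ≡ h
      lemma = solve-∀
    isMinimalPolynomial .IsMinimalPolynomial.least-degree {1} (h ∷ g ∷ []) g≢0 gx+h≈0 =
      contradiction (λ n → ∣-resp (lemma g h (approx x n)) (gx+h≈0 n)) (irrational g h g≢0)
      where
      lemma : ∀ g h x → 1ℤ * (1ℤ * h + 1ℤ * (x * (1ℤ * g + 1ℤ * (x * 0ℤ)))) - 1ℤ * 0ℤ ≡ g * x + h
      lemma = solve-∀
    isMinimalPolynomial .IsMinimalPolynomial.least-degree {suc (suc m)} _ _ _ = s≤s (s≤s z≤n)

    ∈Aₚ : ιᶻ x ∈Aₚ
    ∈Aₚ = record
      { e≤1 = s≤s z≤n ; minPoly = c ∷ b ∷ a ∷ [] ; minimal = isMinimalPolynomial ; x∈pℤₚ = p∣⇒∈pℤₚ x p∣x }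

  -- One step of the algorithm on an element and its polynomial

  sign : Branch → ℤ
  sign use-T₁ = 1ℤ
  sign use-T₂ = - 1ℤ

  signed≡sign* : ∀ br u → signed br u ≡ sign br * u
  signed≡sign* use-T₁ u = sym (ℤ.*-identityˡ u)
  signed≡sign* use-T₂ u = sym (ℤ.-1*i≡-i u)

  sign*sign : ∀ br → sign br * sign br ≡ 1ℤ
  sign*sign use-T₁ = refl
  sign*sign use-T₂ = refl

  sign≢0 : ∀ br → sign br ≢ 0ℤ
  sign≢0 use-T₁ ()
  sign≢0 use-T₂ ()

  p∤d : ∀ {d} → 1 ℕ.≤ d → d ℕ.< p → ¬ (+ p ∣ + d)
  p∤d {suc d} _ d<p p∣d = ℕ∣.>⇒∤ d<p (∣⇒∣ᵤ p∣d)

  module Successor {x a b c} (Q : Quadratic x a b c) (F : Factorisation x a b c) (br : Branch) where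
    open Quadratic Q
    open Factorisation F

    private
      p^j≡ : p^ j ≡ p^ μ * p^ j′
      p^j≡ = trans (cong p^_ j≡) (p^-+ μ j′)

      p^k≡ : p^ k ≡ p^ μ * p^ k′
      p^k≡ = trans (cong p^_ k≡) (p^-+ μ k′)

    ε : ℤ
    ε = sign br

    abstract
      d : ℕ
      d = (- ε * approx q 1) %ℕ p

      d<p : d ℕ.< p
      d<p = n%ℕd<d (- ε * approx q 1) p

      p∣-εq-d : + p ∣ - ε * approx q 1 + - + d
      p∣-εq-d = m∣i-i%m (- ε * approx q 1) p

    -- As qx = -u pᵏ, T(x) = ε u pᵏ / x - d is -εq - d: no inverse in ℤₚ is needed.
    y : ℤₚ
    y = linear (- ε) (- + d) q

    -- Obtained from pʲ q² - bq + a u pᵏ = 0 by q = -ε(y + d) and division by p^μ.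
    a′ b′ c′ : ℤ
    a′ = p^ j′
    b′ = + 2 * + d * a′ + ε * β
    c′ = + d * + d * a′ + ε * β * + d + a * (u * p^ k′)

    d≢0 : d ≢ 0
    -- For d = 0 the choice of `d` would give p ∣ -εq, hence p ∣ q.
    d≢0 d≡0 = q-unit (∣-resp
      (trans (cong (λ d → - ε * (- ε * approx q 1 + - + d)) d≡0)
        (trans (lemma ε (approx q 1)) (trans (cong (_* approx q 1) (sign*sign br)) (ℤ.*-identityˡ _))))
      (∣n⇒∣m*n (- ε) p∣-εq-d))
      where
      lemma : ∀ e q → - e * (- e * q + - 0ℤ) ≡ e * e * q
      lemma = solve-∀

    1≤d : 1 ℕ.≤ d
    1≤d = ℕ.n≢0⇒n>0 d≢0

    root′ : IsZero (quadratic a′ b′ c′ y)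
    root′ = cancel-p^-IsZero μ (quadratic a′ b′ c′ y) λ n → ∣-resp (identity (approx q n)) (q-root n)
      where
      lemma : ∀ r s t q a u e β d →
        r * s * (q * q) + - (β * r) * q + a * (u * (r * t))
          + (e * e - 1ℤ) * (r * s * (q * q) - r * β * q)
        ≡ r * (s * ((- e * q + - d) * (- e * q + - d)) + (+ 2 * d * s + e * β) * (- e * q + - d)
              + (d * d * s + e * β * d + a * (u * t)))
      lemma = solve-∀
      identity : ∀ q →
        p^ j * (q * q) + - b * q + a * (u * p^ k)
        ≡ p^ μ * (a′ * ((- ε * q + - + d) * (- ε * q + - + d)) + b′ * (- ε * q + - + d) + c′)
      identity q = begin
        p^ j * (q * q) + - b * q + a * (u * p^ k)
          ≡⟨ cong₂ (λ r s → r * (q * q) + - b * q + a * (u * s)) p^j≡ p^k≡ ⟩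
        p^ μ * a′ * (q * q) + - b * q + a * (u * (p^ μ * p^ k′))
          ≡⟨ cong (λ b → p^ μ * a′ * (q * q) + - b * q + a * (u * (p^ μ * p^ k′))) b≡ ⟩
        z
          -- ε² = 1 enters the ring identity as a multiple of ε² - 1.
          ≡⟨ ℤ.+-identityʳ z ⟨
        z + (1ℤ - 1ℤ) * (p^ μ * a′ * (q * q) - p^ μ * β * q)
          ≡⟨ cong (λ e → z + (e - 1ℤ) * (p^ μ * a′ * (q * q) - p^ μ * β * q)) (sym (sign*sign br)) ⟩
        z + (ε * ε - 1ℤ) * (p^ μ * a′ * (q * q) - p^ μ * β * q)
          ≡⟨ lemma (p^ μ) a′ (p^ k′) q a u ε β (+ d) ⟩
        p^ μ * (a′ * ((- ε * q + - + d) * (- ε * q + - + d)) + b′ * (- ε * q + - + d) + c′) ∎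
        where
        open ≡-Reasoning
        z = p^ μ * a′ * (q * q) + - (β * p^ μ) * q + a * (u * (p^ μ * p^ k′))

    -- A common divisor divides p^j′, εβ and a u p^k′. By `minimum`, either p^j′ = 1, or k′ = 0 and
    -- a u is prime to `p`, hence coprime to p^j′.
    coprime′ : Coprime (c′ ∷ b′ ∷ a′ ∷ [])
    coprime′ m (m∣c′ ∷ m∣b′ ∷ m∣a′ ∷ []) = by-minimum minimum
      where
      m∣εβ : + m ∣ ε * β
      m∣εβ = ∣m+n∣m⇒∣n m∣b′ (∣n⇒∣m*n (+ 2 * + d) m∣a′)
      m∣aup^ : + m ∣ a * (u * p^ k′)
      m∣aup^ = ∣m+n∣m⇒∣n m∣c′ (∣m∣n⇒∣m+n (∣n⇒∣m*n (+ d * + d) m∣a′) (∣m⇒∣m*n (+ d) m∣εβ))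
      by-minimum : j′ ≡ 0 ⊎ (k′ ≡ 0 × ¬ (+ p ∣ a)) → m ≡ 1
      by-minimum (inj₁ j′≡0) = ℕ∣.∣1⇒≡1 (∣⇒∣ᵤ (subst (λ e → + m ∣ p^ e) j′≡0 m∣a′))
      by-minimum (inj₂ (k′≡0 , p∤a)) = p∤-coprime j′ m
        (λ p∣au → [ p∤a , p∤u ]′ (euclid a u p∣au)) m∣a′
        (∣-resp (cong (a *_) (ℤ.*-identityʳ u)) (subst (λ e → + m ∣ a * (u * p^ e)) k′≡0 m∣aup^))

    -- `y` is affine in `x` over ℚ: with pʲ q = ax + b, multiplying gy + h by pʲ gives a linear form
    -- in `x` with leading coefficient -εga ≠ 0.
    irrational′ : ∀ g h → g ≢ 0ℤ → ¬ IsZero (linear g h y)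
    irrational′ g h g≢0 gy+h≈0 = irrational (- ε * g * a) (- ε * g * b + p^ j * (h - g * + d))
      (λ eq → [ [ -ε≢0 , g≢0 ]′ ∘ ℤ.i*j≡0⇒i≡0∨j≡0 (- ε) , a≢0 ]′ (ℤ.i*j≡0⇒i≡0∨j≡0 (- ε * g) eq))
      λ n → ∣-resp (lemma (p^ j) (approx q n) a b (approx x n) ε g h (+ d))
        (∣m∣n⇒∣m-n (∣n⇒∣m*n (p^ j) (gy+h≈0 n)) (∣n⇒∣m*n (- ε * g) (q≈ n)))
      where
      -ε≢0 : - ε ≢ 0ℤ
      -ε≢0 = sign≢0 br ∘ ℤ.neg-injective
      lemma : ∀ r q a b x e g h d →
        r * (g * (- e * q + - d) + h) - - e * g * (r * q - (a * x + b))
        ≡ - e * g * a * x + (- e * g * b + r * (h - g * d))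
      lemma = solve-∀

    quadratic′ : Quadratic y a′ b′ c′
    quadratic′ = record
      { 0<a = ℤ.+<+ (ℕ.m^n>0 p j′) ; coprime = coprime′ ; root = root′ ; p∣x = p∣-εq-d ; irrational = irrational′ }

    -- p^2μ splits off from both b² and 4ac. What remains is the discriminant of p^j′ q² - βq + a u
    -- p^k′, which the substitution q = -ε(y + d) preserves because ε² = 1.
    discriminant≡ : discriminant a b c ≡ discriminant a′ b′ c′ * (p^ μ * p^ μ)
    discriminant≡ = begin
      discriminant a b c
        ≡⟨ cong₂ (discriminant a) b≡ (trans c≡ (cong (u *_) (trans (p^-+ j k) (cong₂ _*_ p^j≡ p^k≡)))) ⟩
      z
        ≡⟨ ℤ.+-identityʳ z ⟨
      z + (1ℤ - 1ℤ) * (β * p^ μ * (β * p^ μ))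
        ≡⟨ cong (λ e → z + (e - 1ℤ) * (β * p^ μ * (β * p^ μ))) (sym (sign*sign br)) ⟩
      z + (ε * ε - 1ℤ) * (β * p^ μ * (β * p^ μ))
        ≡⟨ lemma (p^ μ) a′ (p^ k′) a u ε β (+ d) ⟩
      discriminant a′ b′ c′ * (p^ μ * p^ μ) ∎
      where
      open ≡-Reasoning
      z = β * p^ μ * (β * p^ μ) - + 4 * (a * (u * (p^ μ * a′ * (p^ μ * p^ k′))))
      lemma : ∀ r s t a u e β d →
        β * r * (β * r) - + 4 * (a * (u * (r * s * (r * t)))) + (e * e - 1ℤ) * (β * r * (β * r))
        ≡ ((+ 2 * d * s + e * β) * (+ 2 * d * s + e * β)
           - + 4 * (s * (d * d * s + e * β * d + a * (u * t)))) * (r * r)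
      lemma = solve-∀

    μ≡0⇒j≡0 : μ ≡ 0 → j ≡ 0
    μ≡0⇒j≡0 μ≡0 with minimum
    ... | inj₁ j′≡0       = trans j≡ (cong₂ ℕ._+_ μ≡0 j′≡0)
    ... | inj₂ (k′≡0 , _) =
      contradiction (subst (1 ℕ.≤_) (trans k≡ (cong₂ ℕ._+_ μ≡0 k′≡0)) 1≤k) λ ()

    p∣p^k : + p ∣ p^ k
    p∣p^k = p^1∣⇒p∣ (p^-mono-∣ 1≤k)

    -- Strictness needs D′ ≠ 0 as well as μ ≥ 1. If μ were 0, then j = 0 and the equation of `q`
    -- would be monic; modulo `p` it would reduce to q² ≡ 0, against `q` being a unit.
    p∣b⇒∣discriminant∣-decreases : + p ∣ b →
      ℤ.∣ discriminant a′ b′ c′ ∣ ℕ.< ℤ.∣ discriminant a b c ∣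
    p∣b⇒∣discriminant∣-decreases p∣b = subst (ℤ.∣ D′ ∣ ℕ.<_)
      (sym (trans (cong ℤ.∣_∣ discriminant≡) (ℤ.abs-* D′ (p^ μ * p^ μ))))
      (ℕ.m<m*n ℤ.∣ D′ ∣ _ {{ℕ.≢-nonZero (Quadratic.discriminant≢0 quadratic′ ∘ ℤ.∣i∣≡0⇒i≡0)}}
        (subst (1 ℕ.<_) (trans (ℕ.^-distribˡ-+-* p μ μ) (sym (ℤ.abs-* (p^ μ) (p^ μ)))) (1<p^ (μ ℕ.+ μ)
          (ℕ.≤-trans (ℕ.n≢0⇒n>0 μ≢0) (ℕ.m≤m+n μ μ)))))
      where
      D′ = discriminant a′ b′ c′
      lemma : ∀ q b v → (1ℤ * (q * q) + - b * q + v) + (b * q - v) ≡ q * q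
      lemma = solve-∀
      μ≢0 : μ ≢ 0
      μ≢0 μ≡0 = [ q-unit , q-unit ]′ (euclid (approx q 1) (approx q 1)
        (∣-resp (lemma (approx q 1) b (a * (u * p^ k)))
          (∣m∣n⇒∣m+n
            (p^1∣⇒p∣ (subst (λ e → p^ 1 ∣ approx (quadratic (p^ e) (- b) (a * (u * p^ k)) q) 1)
              (μ≡0⇒j≡0 μ≡0) (q-root 1)))
            (∣m∣n⇒∣m-n (∣m⇒∣m*n (approx q 1) p∣b) (∣n⇒∣m*n a (∣n⇒∣m*n u p∣p^k))))))
      1<p^ : ∀ e → 1 ℕ.≤ e → 1 ℕ.< p ℕ.^ e
      1<p^ (suc e) _ = ℕ.<-≤-trans 1<p (ℕ.m≤m*n p (p ℕ.^ e) {{ℕ.m^n≢0 p e}})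

    module _ (p∤b : ¬ (+ p ∣ b)) where

      private
        μ≡0 : μ ≡ 0
        μ≡0 = ℕ.n≤0⇒n≡0 (ℕ.≮⇒≥ λ 1≤μ → p∤b (p^1∣⇒p∣ (∣-trans (p^-mono-∣ 1≤μ) (divides β b≡))))
        j≡0 : j ≡ 0
        j≡0 = μ≡0⇒j≡0 μ≡0
        j′≡0 : j′ ≡ 0
        j′≡0 = ℕ.m+n≡0⇒n≡0 μ (trans (sym j≡) j≡0)

      c≡u*p^k : c ≡ u * p^ k
      c≡u*p^k = subst (λ j → c ≡ u * p^ (j ℕ.+ k)) j≡0 c≡

      a′≡1 : a′ ≡ 1ℤ
      a′≡1 = cong p^_ j′≡0

      private
        β≡b : β ≡ b
        β≡b = sym (trans b≡ (trans (cong (λ e → β * p^ e) μ≡0) (ℤ.*-identityʳ β)))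

      b′≡ : b′ ≡ + 2 * + d + ε * b
      b′≡ = cong₂ (λ s b → s + ε * b) (trans (cong (+ 2 * + d *_) a′≡1) (ℤ.*-identityʳ (+ 2 * + d))) β≡b

      c′≡ : c′ ≡ + d * + d + ε * b * + d + a * c
      c′≡ = cong₂ _+_
        (cong₂ (λ s b → s + ε * b * + d) (trans (cong (+ d * + d *_) a′≡1) (ℤ.*-identityʳ (+ d * + d))) β≡b)
        (cong (a *_) (trans (cong (λ e → u * p^ e) (sym (trans k≡ (cong (ℕ._+ k′) μ≡0)))) (sym c≡u*p^k)))

      discriminant-preserved : discriminant a′ b′ c′ ≡ discriminant a b c
      discriminant-preserved = sym (trans discriminant≡
        (trans (cong (λ e → discriminant a′ b′ c′ * (p^ e * p^ e)) μ≡0) (ℤ.*-identityʳ _)))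

      -- Since p divides c′ = d² + εbd + ac and `c`, it divides d (d + εb), but not `d`. This pins
      -- `d` down as the residue of -εb.
      p∣d+εb : + p ∣ + d + ε * b
      p∣d+εb = [ (λ h → contradiction h (p∤d 1≤d d<p)) , id ]′ (euclid (+ d) (+ d + ε * b)
        (∣-resp (trans (cong (_- a * c) c′≡) (lemma (+ d) (ε * b) (a * c)))
          (∣m∣n⇒∣m-n (Quadratic.p∣c quadratic′) (∣n⇒∣m*n a p∣c))))
        where
        lemma : ∀ d e f → d * d + e * d + f - f ≡ d * (d + e)
        lemma = solve-∀

      p∤b′ : ¬ (+ p ∣ b′)
      p∤b′ p∣b′ = p∤d 1≤d d<p (∣-resp (trans (cong (_- (+ d + ε * b)) b′≡) (lemma (+ d) (ε * b)))
        (∣m∣n⇒∣m-n p∣b′ p∣d+εb))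
        where
        lemma : ∀ d e → + 2 * d + e - (d + e) ≡ d
        lemma = solve-∀

    module _ (alg : Algorithm) (br≡ : br ≡ branch alg b c) where
      step : Step alg (ιᶻ x) (term (signed br u) (+ k) d) (ιᶻ y)
      step = record
        { x∈Aₚ = ∈Aₚ Q
        ; u = u
        ; u-def = p∤u , (j ℕ.+ k) , c≡
        ; t-def = cong (λ br → signed br u) br≡
        ; valuation = w , w-unit , ιᶻ-cong {x} {fromℤ (p^ k) *ᶻ w}
            λ n → ∣-resp (swap (p^ k * approx w n) (approx x n)) (∣m⇒∣-m (x≈ n))
        ; 1≤d = 1≤d
        ; d<p = d<p
        ; y∈pℤₚ = p∣⇒∈pℤₚ y p∣-εq-d
        ; y-def = λ n → ∣-resp (identity n) (∣n⇒∣m*n (- ε) (q*x≈ n))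
        }
        where
        swap : ∀ r s → - (r - s) ≡ s - r
        swap = solve-∀
        lemma : ∀ e q x d u r → - e * (q * x + u * r)
          ≡ 1ℤ * ((1ℤ * (- e * q + - d) + 1ℤ * d) * x) - 1ℤ * (e * u * r)
        lemma = solve-∀
        identity : ∀ n → - ε * (approx q n * approx x n + u * p^ k)
          ≡ 1ℤ * ((1ℤ * (- ε * approx q n + - + d) + 1ℤ * + d) * approx x n) - 1ℤ * (signed br u * p^ k)
        identity n = trans (lemma ε (approx q n) (approx x n) (+ d) u (p^ k))
          (cong (λ t → 1ℤ * ((1ℤ * (- ε * approx q n + - + d) + 1ℤ * + d) * approx x n) - 1ℤ * (t * p^ k))
            (sym (signed≡sign* br u)))

  -- Bounds on b in Algorithms B and C

  fold-bound : ∀ n d → d ℕ.< p → + p ∣ + d - + n → ℤ.∣ + 2 * + d - + n ∣ ℕ.≤ n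
  fold-bound n d d<p p∣d-n with d ℕ.≤? n
  -- For n < d both would be residues below `p`, congruent and therefore equal.
  ... | no d≰n = contradiction
    (ℕ.≤-reflexive (residue-unique d<p (ℕ.<-trans (ℕ.≰⇒> d≰n) d<p) p∣d-n)) d≰n
  -- With n = d + m, 2d - n is d - m, of absolute value at most d + m.
  ... | yes d≤n = subst₂ ℕ._≤_
    (cong ℤ.∣_∣ (trans (lemma (+ d) (+ m)) (cong (λ n → + 2 * + d - n)
      (trans (sym (ℤ.pos-+ d m)) (cong +_ (ℕ.m+[n∸m]≡n d≤n))))))
    (ℕ.m+[n∸m]≡n d≤n)
    (ℤ.∣i-j∣≤∣i∣+∣j∣ (+ d) (+ m))
    where
    m = n ℕ.∸ d
    lemma : ∀ d m → d - m ≡ + 2 * d - (d + m)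
    lemma = solve-∀

  -- In Algorithm C the coefficient b may grow when b ≥ 0 ≥ c, but then b² ≤ b² - 4c = D.
  growth-bound : ∀ n e d → d ℕ.< p →
    ℤ.∣ + 2 * + d + 1ℤ * + n ∣ ℕ.≤ ℤ.∣ discriminant 1ℤ (+ n) (- + e) ∣ ℕ.+ 2 ℕ.* p
  growth-bound n e d d<p = begin
    ℤ.∣ + 2 * + d + 1ℤ * + n ∣
      ≤⟨ ℤ.∣i+j∣≤∣i∣+∣j∣ (+ 2 * + d) (1ℤ * + n) ⟩
    ℤ.∣ + 2 * + d ∣ ℕ.+ ℤ.∣ 1ℤ * + n ∣
      ≡⟨ cong₂ ℕ._+_ (ℤ.abs-* (+ 2) (+ d)) (cong ℤ.∣_∣ (ℤ.*-identityˡ (+ n))) ⟩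
    2 ℕ.* d ℕ.+ n
      ≡⟨ ℕ.+-comm (2 ℕ.* d) n ⟩
    n ℕ.+ 2 ℕ.* d
      ≤⟨ ℕ.+-mono-≤ (ℕ.≤-trans (n≤n*n n) (ℕ.m≤m+n (n ℕ.* n) (4 ℕ.* e))) (ℕ.*-monoʳ-≤ 2 (ℕ.<⇒≤ d<p)) ⟩
    n ℕ.* n ℕ.+ 4 ℕ.* e ℕ.+ 2 ℕ.* p
      ≡⟨ cong (λ z → ℤ.∣ z ∣ ℕ.+ 2 ℕ.* p) D≡ ⟨
    ℤ.∣ discriminant 1ℤ (+ n) (- + e) ∣ ℕ.+ 2 ℕ.* p ∎
    where
    open ℕ.≤-Reasoning
    n≤n*n : ∀ n → n ℕ.≤ n ℕ.* n
    n≤n*n zero    = z≤n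
    n≤n*n (suc n) = ℕ.m≤m*n (suc n) (suc n)
    lemma : ∀ n e → n * n - + 4 * (1ℤ * - e) ≡ n * n + + 4 * e
    lemma = solve-∀
    D≡ : discriminant 1ℤ (+ n) (- + e) ≡ + (n ℕ.* n ℕ.+ 4 ℕ.* e)
    D≡ = trans (lemma (+ n) (+ e)) (cong₂ _+_ (sym (ℤ.pos-* n n)) (sym (ℤ.pos-* 4 e)))

  -- Except in Algorithm C with b ≥ 0 ≥ c, the branch is chosen so that εb = -|b|, and `fold-bound`
  -- applies. In the exceptional case εb = b, and the bound depends only on the discriminant, which
  -- is constant along a regular orbit.
  b-bound : ∀ alg b c d → alg ≢ A → d ℕ.< p → + p ∣ + d + sign (branch alg b c) * b →
    let b′ = + 2 * + d + sign (branch alg b c) * b in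
    ℤ.∣ b′ ∣ ℕ.≤ ℤ.∣ b ∣ ⊎ ℤ.∣ b′ ∣ ℕ.≤ ℤ.∣ discriminant 1ℤ b c ∣ ℕ.+ 2 ℕ.* p
  b-bound alg b c d alg≢A d<p = by-cases alg b c alg≢A
    where
    fold : ∀ n z → z ≡ - + n → + p ∣ + d + z → ℤ.∣ + 2 * + d + z ∣ ℕ.≤ n
    fold n _ refl = fold-bound n d d<p
    by-cases : ∀ alg b c → alg ≢ A → + p ∣ + d + sign (branch alg b c) * b →
      let b′ = + 2 * + d + sign (branch alg b c) * b in
      ℤ.∣ b′ ∣ ℕ.≤ ℤ.∣ b ∣ ⊎ ℤ.∣ b′ ∣ ℕ.≤ ℤ.∣ discriminant 1ℤ b c ∣ ℕ.+ 2 ℕ.* p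
    by-cases A _        _          A≢A _ = contradiction refl A≢A
    by-cases B (+ n)    _          _   h = inj₁ (fold n _ (ℤ.-1*i≡-i (+ n)) h)
    by-cases B -[1+ n ] _          _   h = inj₁ (fold (suc n) _ (ℤ.*-identityˡ -[1+ n ]) h)
    by-cases C -[1+ n ] _          _   h = inj₁ (fold (suc n) _ (ℤ.*-identityˡ -[1+ n ]) h)
    by-cases C (+ n)    (+ suc e)  _   h = inj₁ (fold n _ (ℤ.-1*i≡-i (+ n)) h)
    by-cases C (+ n)    (+ zero)   _   h = inj₂ (growth-bound n zero d d<p)
    by-cases C (+ n)    -[1+ e ]   _   h = inj₂ (growth-bound n (suc e) d d<p)

  -- The orbit of states and the recurrence of coefficients

  record State : Set where
    no-eta-equality
    field
      {x}     : ℤₚ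
      {a b c} : ℤ
      isRoot  : Quadratic x a b c

    D : ℤ
    D = discriminant a b c

  open State

  Regular : State → Set
  Regular s = a s ≡ 1ℤ × ¬ (+ p ∣ b s)

  abstract
    factorisation : ∀ s → Factorisation (x s) (a s) (b s) (c s)
    factorisation s = factorise (isRoot s)

  module _ (alg : Algorithm) where

    branchOf : State → Branch
    branchOf s = branch alg (b s) (c s)

    module Next (s : State) = Successor (isRoot s) (factorisation s) (branchOf s)

    termOf : State → Term
    termOf s = term (signed (branchOf s) (Factorisation.u (factorisation s)))
      (+ Factorisation.k (factorisation s)) (Next.d s)

    abstract
      -- Opaque: the rest of the proof uses `next` only through the properties that follow in this
      -- block.
      next : State → State
      next s = record { isRoot = Next.quadratic′ s }

      next-step : ∀ s → Step alg (ιᶻ (x s)) (termOf s) (ιᶻ (x (next s)))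
      next-step s = Next.step s alg refl

      next-decreases : ∀ s → + p ∣ b s → ℤ.∣ D (next s) ∣ ℕ.< ℤ.∣ D s ∣
      next-decreases s = Next.p∣b⇒∣discriminant∣-decreases s

      next-regular : ∀ s → ¬ (+ p ∣ b s) → Regular (next s)
      next-regular s p∤b = Next.a′≡1 s p∤b , Next.p∤b′ s p∤b

      next-D : ∀ s → ¬ (+ p ∣ b s) → D (next s) ≡ D s
      next-D s = Next.discriminant-preserved s

      next-b : ∀ s → ¬ (+ p ∣ b s) → b (next s) ≡ + 2 * + Next.d s + Next.ε s * b s
      next-b s = Next.b′≡ s

      next-c : ∀ s → ¬ (+ p ∣ b s) →
        c (next s) ≡ + Next.d s * + Next.d s + Next.ε s * b s * + Next.d s + a s * c s
      next-c s = Next.c′≡ s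

    states : State → ℕ → State
    states s zero    = s
    states s (suc i) = next (states s i)

    regular-eventually : ∀ s → ∃[ n ] Regular (states s n)
    regular-eventually s = go 0 (<-wellFounded _)
      where
      go : ∀ i → Acc ℕ._<_ ℤ.∣ D (states s i) ∣ → ∃[ n ] Regular (states s n)
      go i (acc rec) with + p ∣? b (states s i)
      ... | no  p∤b = suc i , next-regular (states s i) p∤b
      ... | yes p∣b = go (suc i) (rec (next-decreases (states s i) p∣b))

    -- The roots in ℤₚ are left out on purpose: the coefficients already determine the terms and the
    -- next coefficients, so equality of p-adic numbers never has to be shown.
    record SameCoefficients (s s′ : State) : Set where
      field
        b≡ : b s ≡ b s′
        c≡ : c s ≡ c s′

    -- With a = 1, 4c is b² - D.
    same-b⇒same-c : ∀ s s′ → Regular s → Regular s′ → D s ≡ D s′ → b s ≡ b s′ → c s ≡ c s′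
    same-b⇒same-c s s′ (a≡1 , _) (a≡1′ , _) D≡ b≡ =
      trans (sym (ℤ.*-identityˡ (c s))) (trans (cong (_* c s) (sym a≡1)) (trans ac≡
        (trans (cong (_* c s′) a≡1′) (ℤ.*-identityˡ (c s′)))))
      where
      lemma : ∀ b ac → b * b - (b * b - + 4 * ac) ≡ + 4 * ac
      lemma = solve-∀
      ac≡ : a s * c s ≡ a s′ * c s′
      ac≡ = ℤ.*-cancelˡ-≡ (+ 4) _ _ (trans (sym (lemma (b s) (a s * c s)))
        (trans (cong₂ (λ b D → b * b - D) b≡ D≡) (lemma (b s′) (a s′ * c s′))))

    d-unique : ∀ s s′ → Regular s → Regular s′ → SameCoefficients s s′ → Next.d s ≡ Next.d s′
    d-unique s s′ (_ , p∤b) (_ , p∤b′) same = residue-unique (Next.d<p s) (Next.d<p s′)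
      (∣-resp (trans (cong (λ e → + Next.d s + Next.ε s * b s - (+ Next.d s′ + e)) (sym εb≡))
                (lemma (+ Next.d s) (+ Next.d s′) (Next.ε s * b s)))
        (∣m∣n⇒∣m-n (Next.p∣d+εb s p∤b) (Next.p∣d+εb s′ p∤b′)))
      where
      open SameCoefficients same
      εb≡ : Next.ε s * b s ≡ Next.ε s′ * b s′
      εb≡ = cong₂ (λ b c → sign (branch alg b c) * b) b≡ c≡
      lemma : ∀ d d′ e → d + e - (d′ + e) ≡ d - d′
      lemma = solve-∀

    -- p ∤ b gives j = 0, so c = u pᵏ, and unique factorisation recovers `u` and `k` from `c`.
    same-term : ∀ s s′ → Regular s → Regular s′ → SameCoefficients s s′ → termOf s ≡ termOf s′
    same-term s s′ r@(_ , p∤b) r′@(_ , p∤b′) same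
      with prime-to-p-factorisation-unique
             (Factorisation.k (factorisation s)) (Factorisation.k (factorisation s′))
             (Factorisation.p∤u (factorisation s)) (Factorisation.p∤u (factorisation s′))
             (trans (sym (Next.c≡u*p^k s p∤b)) (trans (SameCoefficients.c≡ same) (Next.c≡u*p^k s′ p∤b′)))
    ... | u≡ , k≡ = cong₂ (λ t f → f t)
      (cong₂ signed (cong₂ (branch alg) (SameCoefficients.b≡ same) (SameCoefficients.c≡ same)) u≡)
      (cong₂ (λ k d t → term t (+ k) d) k≡ (d-unique s s′ r r′ same))

    same-next : ∀ s s′ → Regular s → Regular s′ → SameCoefficients s s′ →
      SameCoefficients (next s) (next s′)
    same-next s s′ r@(a≡1 , p∤b) r′@(a≡1′ , p∤b′) same = record
      { b≡ = trans (next-b s p∤b) (trans (cong₂ (λ d e → + 2 * + d + e) d≡ εb≡) (sym (next-b s′ p∤b′)))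
      ; c≡ = trans (next-c s p∤b)
          (trans (cong₂ _+_ (cong₂ (λ d e → + d * + d + e * + d) d≡ εb≡)
                   (cong₂ _*_ (trans a≡1 (sym a≡1′)) (SameCoefficients.c≡ same)))
            (sym (next-c s′ p∤b′)))
      }
      where
      d≡ = d-unique s s′ r r′ same
      εb≡ : Next.ε s * b s ≡ Next.ε s′ * b s′
      εb≡ = cong₂ (λ b c → sign (branch alg b c) * b) (SameCoefficients.b≡ same) (SameCoefficients.c≡ same)

    regular-states : ∀ {s} → Regular s → ∀ i → Regular (states s i)
    regular-states r zero    = r
    regular-states r (suc i) = next-regular _ (proj₂ (regular-states r i))

    D-states : ∀ {s} → Regular s → ∀ i → D (states s i) ≡ D s
    D-states r zero    = refl
    D-states r (suc i) = trans (next-D _ (proj₂ (regular-states r i))) (D-states r i)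

    states-+ : ∀ s m n → states s (m ℕ.+ n) ≡ states (states s n) m
    states-+ s zero    n = refl
    states-+ s (suc m) n = cong next (states-+ s m n)

    -- The sum dominates both alternatives of `b-bound`: the first passes an earlier bound on, the
    -- second is |D| + 2p with `D` constant.
    bounded : alg ≢ A → ∀ {s} → Regular s → ∀ i →
      ℤ.∣ b (states s i) ∣ ℕ.≤ ℤ.∣ b s ∣ ℕ.+ (ℤ.∣ D s ∣ ℕ.+ 2 ℕ.* p)
    bounded alg≢A {s} r zero    = ℕ.m≤m+n _ _
    bounded alg≢A {s} r (suc i) = [ (λ h → ℕ.≤-trans h (bounded alg≢A r i)) , (λ h → ℕ.≤-trans h
      (ℕ.≤-trans (ℕ.≤-reflexive (cong (λ D → ℤ.∣ D ∣ ℕ.+ 2 ℕ.* p) D≡))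
        (ℕ.m≤n+m (ℤ.∣ D s ∣ ℕ.+ 2 ℕ.* p) ℤ.∣ b s ∣))) ]′
      (subst (λ b′ → ℤ.∣ b′ ∣ ℕ.≤ ℤ.∣ b sᵢ ∣ ⊎ ℤ.∣ b′ ∣ ℕ.≤ ℤ.∣ discriminant 1ℤ (b sᵢ) (c sᵢ) ∣ ℕ.+ 2 ℕ.* p)
        (sym (next-b sᵢ p∤b))
        (b-bound alg (b sᵢ) (c sᵢ) (Next.d sᵢ) alg≢A (Next.d<p sᵢ) (Next.p∣d+εb sᵢ p∤b)))
      where
      sᵢ = states s i
      a≡1 = proj₁ (regular-states r i)
      p∤b = proj₂ (regular-states r i)
      D≡ : discriminant 1ℤ (b sᵢ) (c sᵢ) ≡ D s
      D≡ = trans (cong (λ a → discriminant a (b sᵢ) (c sᵢ)) (sym a≡1)) (D-states r i)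

    recurrent-b : alg ≢ A → ∀ {s} → Regular s →
      ∃₂ λ i j → i ℕ.< j × b (states s i) ≡ b (states s j)
    -- Integers of absolute value at most `N` are coded by sign and absolute value; there are 2(N +
    -- 1) codes and one index more.
    recurrent-b alg≢A {s} r = decode (Fin.pigeonhole (ℕ.n<1+n _) (encode ∘ toℕ))
      where
      N = ℤ.∣ b s ∣ ℕ.+ (ℤ.∣ D s ∣ ℕ.+ 2 ℕ.* p)
      bit : Sign.Sign → Fin 2
      bit Sign.+ = Fin.zero
      bit Sign.- = Fin.suc Fin.zero
      bit-injective : ∀ σ τ → bit σ ≡ bit τ → σ ≡ τ
      bit-injective Sign.+ Sign.+ _ = refl
      bit-injective Sign.- Sign.- _ = refl
      absolute : ∀ i → Fin (suc N)
      absolute i = fromℕ< (s≤s (bounded alg≢A r i))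
      encode : ℕ → Fin (2 ℕ.* suc N)
      encode i = combine (bit (ℤ.sign (b (states s i)))) (absolute i)
      encode-injective : ∀ i j → encode i ≡ encode j → b (states s i) ≡ b (states s j)
      encode-injective i j eq
        with bit≡ , abs≡ ← Fin.combine-injective _ (absolute i) _ (absolute j) eq
        = ℤ.◃-cong (bit-injective _ _ bit≡)
            (trans (sym (Fin.toℕ-fromℕ< _)) (trans (cong toℕ abs≡) (Fin.toℕ-fromℕ< _)))
      decode : ∃₂ (λ (i j : Fin (suc (2 ℕ.* suc N))) → i Fin.< j × encode (toℕ i) ≡ encode (toℕ j)) →
        ∃₂ λ i j → i ℕ.< j × b (states s i) ≡ b (states s j)
      decode (i , j , i<j , eq) = toℕ i , toℕ j , i<j , encode-injective (toℕ i) (toℕ j) eq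

  -- In Algorithm A, b′ = 2d - b ≡ d ≡ b modulo p, so the next d is the same and b″ = 2d - b′ = b.
  A-recurrent-b : ∀ {s} → Regular s → b (states A s 0) ≡ b (states A s 2)
  A-recurrent-b {s} (_ , p∤b) = sym (begin
    b (next A s′)                                    ≡⟨ next-b A s′ p∤b′ ⟩
    + 2 * + N.d s′ + - 1ℤ * b s′                     ≡⟨ cong (λ b → + 2 * + N.d s′ + - 1ℤ * b) (next-b A s p∤b) ⟩
    + 2 * + N.d s′ + - 1ℤ * (+ 2 * + N.d s + - 1ℤ * b s)
      ≡⟨ cong (λ d → + 2 * + d + - 1ℤ * (+ 2 * + N.d s + - 1ℤ * b s)) d′≡d ⟩
    + 2 * + N.d s + - 1ℤ * (+ 2 * + N.d s + - 1ℤ * b s) ≡⟨ lemma (+ N.d s) (b s) ⟩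
    b s                                              ∎)
    where
    open ≡-Reasoning
    module N = Next A
    s′ = next A s
    p∤b′ : ¬ (+ p ∣ b s′)
    p∤b′ = proj₂ (next-regular A s p∤b)
    lemma : ∀ d b → + 2 * d + - 1ℤ * (+ 2 * d + - 1ℤ * b) ≡ b
    lemma = solve-∀
    lemma′ : ∀ d d′ b → d′ + - 1ℤ * (+ 2 * d + - 1ℤ * b) + (d + - 1ℤ * b) ≡ d′ - d
    lemma′ = solve-∀
    d′≡d : N.d s′ ≡ N.d s
    d′≡d = residue-unique (N.d<p s′) (N.d<p s)
      (∣-resp (trans (cong (λ b′ → + N.d s′ + - 1ℤ * b′ + (+ N.d s + - 1ℤ * b s)) (next-b A s p∤b))
                (lemma′ (+ N.d s) (+ N.d s′) (b s)))
        (∣m∣n⇒∣m+n (N.p∣d+εb s′ p∤b′) (N.p∣d+εb s p∤b)))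

  recurrent : ∀ alg {s} → Regular s → ∃₂ λ i j → i ℕ.< j × b (states alg s i) ≡ b (states alg s j)
  recurrent A r = 0 , 2 , s≤s z≤n , A-recurrent-b r
  recurrent B r = recurrent-b B (λ ()) r
  recurrent C r = recurrent-b C (λ ()) r

  periodic-terms : ∀ alg {s} → Regular s →
    ∃₂ λ i j → i ℕ.< j × (∀ m → termOf alg (states alg s (m ℕ.+ i)) ≡ termOf alg (states alg s (m ℕ.+ j)))
  periodic-terms alg {s} r with i , j , i<j , b≡ ← recurrent alg r = i , j , i<j , λ m →
    same-term alg (states alg s (m ℕ.+ i)) (states alg s (m ℕ.+ j))
      (regular-states alg r (m ℕ.+ i)) (regular-states alg r (m ℕ.+ j)) (same m)
    where
    same : ∀ m → SameCoefficients alg (states alg s (m ℕ.+ i)) (states alg s (m ℕ.+ j))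
    same zero = record
      { b≡ = b≡
      ; c≡ = same-b⇒same-c alg (states alg s i) (states alg s j) (regular-states alg r i) (regular-states alg r j)
          (trans (D-states alg r i) (sym (D-states alg r j))) b≡ }
    same (suc m) =
      same-next alg (states alg s (m ℕ.+ i)) (states alg s (m ℕ.+ j))
        (regular-states alg r (m ℕ.+ i)) (regular-states alg r (m ℕ.+ j)) (same m)

  eventually-periodic : ∀ α (s : State) → ιᶻ (x s) ≈ ⟨ α ⟩ → ∀ alg → HasEventuallyPeriodicExpansion alg α
  eventually-periodic α s start alg = from-regular (regular-eventually alg s)
    where
    expansion : InfiniteExpansion alg α
    expansion = record
      { orbit = λ i → ιᶻ (x (states alg s i))
      ; terms = λ i → termOf alg (states alg s i)
      ; start = start
      ; steps = λ i → next-step alg (states alg s i)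
      }
    module _ (n i j : ℕ) (i<j : i ℕ.< j)
      (same : ∀ m → termOf alg (states alg (states alg s n) (m ℕ.+ i))
                  ≡ termOf alg (states alg (states alg s n) (m ℕ.+ j)))
      where
      periodic : ∀ m → i ℕ.+ n ℕ.≤ m →
        termOf alg (states alg s (m ℕ.+ (j ℕ.∸ i))) ≡ termOf alg (states alg s m)
      periodic m i+n≤m = begin
        termOf alg (states alg s (m ℕ.+ (j ℕ.∸ i)))
          ≡⟨ cong (λ m → termOf alg (states alg s m)) shifted ⟩
        termOf alg (states alg s (m′ ℕ.+ j ℕ.+ n))
          ≡⟨ cong (termOf alg) (states-+ alg s (m′ ℕ.+ j) n) ⟩
        termOf alg (states alg (states alg s n) (m′ ℕ.+ j))
          ≡⟨ same m′ ⟨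
        termOf alg (states alg (states alg s n) (m′ ℕ.+ i))
          ≡⟨ cong (termOf alg) (states-+ alg s (m′ ℕ.+ i) n) ⟨
        termOf alg (states alg s (m′ ℕ.+ i ℕ.+ n))
          ≡⟨ cong (λ m → termOf alg (states alg s m)) m≡ ⟨
        termOf alg (states alg s m) ∎
        where
        open ≡-Reasoning
        m′ = m ℕ.∸ (i ℕ.+ n)
        m≡ : m ≡ m′ ℕ.+ i ℕ.+ n
        m≡ = sym (trans (ℕ.+-assoc m′ i n) (ℕ.m∸n+n≡m i+n≤m))
        shifted : m ℕ.+ (j ℕ.∸ i) ≡ m′ ℕ.+ j ℕ.+ n
        shifted = trans (cong (ℕ._+ (j ℕ.∸ i)) m≡) (trans (rearrange m′ i n (j ℕ.∸ i))
          (cong (λ j → m′ ℕ.+ j ℕ.+ n) (ℕ.m+[n∸m]≡n (ℕ.<⇒≤ i<j))))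
          where
          rearrange : ∀ m i n ℓ → m ℕ.+ i ℕ.+ n ℕ.+ ℓ ≡ m ℕ.+ (i ℕ.+ ℓ) ℕ.+ n
          rearrange = ℕ-solve-∀
    from-period : ∀ n → (∃₂ λ (i j : ℕ) → i ℕ.< j × (∀ m →
      termOf alg (states alg (states alg s n) (m ℕ.+ i))
      ≡ termOf alg (states alg (states alg s n) (m ℕ.+ j)))) →
      HasEventuallyPeriodicExpansion alg α
    from-period n (i , j , i<j , same) =
      -- `n` steps lead to a regular state and `i` more to the first occurrence of the recurring
      -- `b`.
      expansion , j ℕ.∸ i , i ℕ.+ n , ℕ.m<n⇒0<n∸m i<j , periodic n i j i<j same
    from-regular : (∃[ n ] Regular (states alg s n)) → HasEventuallyPeriodicExpansion alg α
    from-regular (n , r) = from-period n (periodic-terms alg r)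

  -- The fractional part of α as an initial state

  truncate≡ : ∀ X n → truncate X n ≡ (approx X n %ℕ (p ℕ.^ n)) {{ℕ.m^n≢0 p n}}
  truncate≡ X zero    = sym (ℕ.n<1⇒n≡0 (n%ℕd<d (approx X 0) 1))
  -- Digit `n` is the quotient of r = X mod p^(n+1) by pⁿ; the remainder is X mod pⁿ by coherence.
  truncate≡ X (suc n) = trans
    (cong (ℕ._+ r ℕ./ p ℕ.^ n ℕ.* p ℕ.^ n)
      (trans (truncate≡ X n) (residue-unique (n%ℕd<d (approx X n) (p ℕ.^ n)) (n%ℕd<d (+ r) (p ℕ.^ n)) same)))
    (sym (ℕ.m≡m%n+[m/n]*n r (p ℕ.^ n)))
    where
    instance
      pⁿ≢0 : NonZero (p ℕ.^ n)
      pⁿ≢0 = ℕ.m^n≢0 p n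
      pⁿ⁺¹≢0 : NonZero (p ℕ.^ suc n)
      pⁿ⁺¹≢0 = ℕ.m^n≢0 p (suc n)
    r = approx X (suc n) %ℕ (p ℕ.^ suc n)
    lemma : ∀ x x′ s r t → (x′ - r) + (r - t) - (x′ - x) - (x - s) ≡ s - t
    lemma = solve-∀
    same : p^ n ∣ + (approx X n %ℕ (p ℕ.^ n)) - + (r ℕ.% p ℕ.^ n)
    same = ∣-resp (lemma (approx X n) (approx X (suc n)) (+ (approx X n %ℕ (p ℕ.^ n))) (+ r) (+ (r ℕ.% p ℕ.^ n)))
      (∣m∣n⇒∣m-n
        (∣m∣n⇒∣m-n
          (∣m∣n⇒∣m+n (∣-trans (p^-mono-∣ (ℕ.n≤1+n n)) (m∣i-i%m (approx X (suc n)) (p ℕ.^ suc n)))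
                      (m∣i-i%m (+ r) (p ℕ.^ n)))
          (coherent X n))
        (m∣i-i%m (approx X n) (p ℕ.^ n)))

  p^∣-truncate : ∀ X n → p^ n ∣ approx X n - + truncate X n
  p^∣-truncate X n = ∣-resp (cong (λ t → approx X n - + t) (sym (truncate≡ X n)))
    (m∣i-i%m (approx X n) (p ℕ.^ n) {{ℕ.m^n≢0 p n}})

  cancel-IsZero : ∀ {g} → g ≢ 0ℤ → ∀ z → IsZero (fromℤ g *ᶻ z) → IsZero z
  cancel-IsZero {g} g≢0 z h n = decidable-stable (p^ n ∣? approx z n) λ p^n∤z →
    ¬IsZero-* (fromℤ g) z (fromℤ-¬IsZero g≢0) (λ z≈0 → p^n∤z (z≈0 n)) h

  primitive-part : ∀ {x a b c} → 0ℤ ℤ.< a → IsZero (quadratic a b c x) → + p ∣ approx x 1 →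
    (∀ g h → g ≢ 0ℤ → ¬ IsZero (linear g h x)) →
    ∃[ a ] ∃[ b ] ∃[ c ] Quadratic x a b c
  primitive-part {x} {a} {b} {c} 0<a root p∣x irrational = a′ , b′ , c′ , record
    { 0<a        = ℤ.*-cancelʳ-<-nonNeg (+ g) (subst (0ℤ ℤ.<_) a≡ 0<a)
    -- If `m` divides all three quotients, then m g divides the gcd `g`, so m = 1.
    ; coprime    = λ { m (m∣c′ ∷ m∣b′ ∷ m∣a′ ∷ []) → ℕ∣.∣1⇒≡1 (ℕ∣.*-cancelʳ-∣ g {{g≢0}}
        (subst (m ℕ.* g ℕ∣.∣_) (sym (ℕ.*-identityˡ g))
          (gcd-greatest (gcd-greatest (scale m∣a′ a≡) (scale m∣b′ b≡)) (scale m∣c′ c≡)))) }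
    ; root       = cancel-IsZero (λ g≡0 → ℕ.≢-nonZero⁻¹ g {{g≢0}} (ℤ.+-injective g≡0)) (quadratic a′ b′ c′ x) λ n →
        ∣-resp (trans (cong₂ (λ a b → a * (approx x n * approx x n) + b * approx x n + c) a≡ b≡)
                 (trans (cong (λ c → a′ * + g * (approx x n * approx x n) + b′ * + g * approx x n + c) c≡)
                   (lemma (+ g) a′ b′ c′ (approx x n))))
          (root n)
    ; p∣x        = p∣x
    ; irrational = irrational
    }
    where
    g : ℕ
    g = gcd (gcd ℤ.∣ a ∣ ℤ.∣ b ∣) ℤ.∣ c ∣
    g∣a : + g ∣ a
    g∣a = ∣ᵤ⇒∣ (ℕ∣.∣-trans (gcd[m,n]∣m _ ℤ.∣ c ∣) (gcd[m,n]∣m ℤ.∣ a ∣ ℤ.∣ b ∣))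
    g∣b : + g ∣ b
    g∣b = ∣ᵤ⇒∣ (ℕ∣.∣-trans (gcd[m,n]∣m _ ℤ.∣ c ∣) (gcd[m,n]∣n ℤ.∣ a ∣ ℤ.∣ b ∣))
    g∣c : + g ∣ c
    g∣c = ∣ᵤ⇒∣ (gcd[m,n]∣n (gcd ℤ.∣ a ∣ ℤ.∣ b ∣) ℤ.∣ c ∣)
    a′ = _∣_.quotient g∣a
    b′ = _∣_.quotient g∣b
    c′ = _∣_.quotient g∣c
    a≡ : a ≡ a′ * + g
    a≡ = _∣_.equality g∣a
    b≡ : b ≡ b′ * + g
    b≡ = _∣_.equality g∣b
    c≡ : c ≡ c′ * + g
    c≡ = _∣_.equality g∣c
    g≢0 : NonZero g
    g≢0 = ℕ.≢-nonZero λ g≡0 → ℤ.<-irrefl refl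
      (subst (0ℤ ℤ.<_) (trans a≡ (trans (cong (λ g → a′ * + g) g≡0) (ℤ.*-zeroʳ a′))) 0<a)
    scale : ∀ {m z q} → + m ∣ q → z ≡ q * + g → m ℕ.* g ℕ∣.∣ ℤ.∣ z ∣
    scale {m} {z} {q} m∣q refl = subst (ℕ∣._∣ ℤ.∣ q * + g ∣) (ℤ.abs-* (+ m) (+ g)) (∣⇒∣ᵤ (*-monoˡ-∣ (+ g) m∣q))
    lemma : ∀ g a b c x → a * g * (x * x) + b * g * x + c * g ≡ g * (a * (x * x) + b * x + c)
    lemma = solve-∀

  -- With P = pᴺ and X = T + P x₀, the polynomials used are P² f(X/P), in X and then in x₀.
  fractional-part : ∀ α → IsQuadratic α → Σ[ s ∈ State ] ιᶻ (x s) ≈ ⟨ α ⟩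
  fractional-part α@(X /p^ N) (c ∷ b ∷ a ∷ [] , minimal) =
    record { isRoot = proj₂ (proj₂ (proj₂ minimal₀)) } , start
    where
    open IsMinimalPolynomial minimal
    P T : ℤ
    P = p^ N
    T = + truncate X (suc N)

    Z : ℤₚ
    Z = X +ᶻ fromℤ (- T)

    -- `T` keeps the digits 0,...,N, one more than the denominator pᴺ accounts for; the extra factor
    -- `p` puts `x₀` into pℤₚ.
    p^∣Z : p^ suc N ∣ approx Z (suc N)
    p^∣Z = p^∣-truncate X (suc N)

    p^N∣Z : p^ N ∣ approx Z N
    p^N∣Z = lower Z ℕ.≤-refl (ℕ.n≤1+n N) (∣-trans (p^-mono-∣ (ℕ.n≤1+n N)) p^∣Z)

    x₀ : ℤₚ
    x₀ = divide-p^ N Z p^N∣Z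

    x₀≈ : fromℤ P *ᶻ x₀ ≈ᶻ Z
    x₀≈ = divide-p^-≈ N Z p^N∣Z

    p∣x₀ : + p ∣ approx x₀ 1
    p∣x₀ = p^1∣⇒p∣ (lower x₀ ℕ.≤-refl (s≤s z≤n) (p^-cancel 1 N
      (∣m+n∣n⇒∣m (x₀≈ (suc N)) (∣m⇒∣-m p^∣Z))))

    start : ιᶻ x₀ ≈ ⟨ α ⟩
    start n = ∣-resp
      (trans (lemma P (approx x₀ n) (approx X n) T)
        (cong (λ r → r * approx x₀ n - 1ℤ * (P * approx X n + P * - T)) (sym (p^-+ N N))))
      (∣n⇒∣m*n P (x₀≈ n))
      where
      lemma : ∀ r x y t → r * (r * x - (y + - t)) ≡ r * r * x - 1ℤ * (r * y + r * - t)
      lemma = solve-∀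

    p^N0 : p^ (N ℕ.+ 0) ≡ P * 1ℤ
    p^N0 = p^-+ N 0

    p^2N : p^ (N ℕ.+ (N ℕ.+ 0)) ≡ P * (P * 1ℤ)
    p^2N = trans (p^-+ N (N ℕ.+ 0)) (cong (P *_) p^N0)

    p^3N : p^ (N ℕ.+ (N ℕ.+ (N ℕ.+ 0))) ≡ P * (P * (P * 1ℤ))
    p^3N = trans (p^-+ N (N ℕ.+ (N ℕ.+ 0))) (cong (P *_) p^2N)

    -- `eval` does not cancel denominators: Horner's scheme ends over P³ where P² would do. The
    -- spare factor `P` is cancelled here.
    X-root : IsZero (quadratic a (b * P) (c * (P * P)) X)
    X-root = cancel-p^-IsZero N (quadratic a (b * P) (c * (P * P)) X) λ n → ∣-resp
      (trans (cong₂ (λ r s → value (approx X n) r s (p^ (N ℕ.+ (N ℕ.+ (N ℕ.+ 0))))) p^N0 p^2N)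
        (trans (cong (value (approx X n) (P * 1ℤ) (P * (P * 1ℤ))) p^3N)
          (lemma P a b c (approx X n))))
      (root n)
      where
      value : ℤ → ℤ → ℤ → ℤ → ℤ
      value x r s t =
        1ℤ * (t * c + 1ℤ * (x * (s * b + 1ℤ * (x * (r * a + 1ℤ * (x * 0ℤ)))))) - t * 0ℤ
      lemma : ∀ r a b c x →
        1ℤ * (r * (r * (r * 1ℤ)) * c
               + 1ℤ * (x * (r * (r * 1ℤ) * b + 1ℤ * (x * (r * 1ℤ * a + 1ℤ * (x * 0ℤ))))))
          - r * (r * (r * 1ℤ)) * 0ℤ
        ≡ r * (a * (x * x) + b * r * x + c * (r * r))
      lemma = solve-∀

    irrational : ∀ g h → g ≢ 0ℤ → ¬ IsZero (linear g h x₀)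
    irrational g h g≢0 gx+h≈0 = contradiction
      -- From P x₀ = X - T and α = X/P, P (g x₀ + h) equals gP α + (P h - g T), a linear polynomial
      -- at α.
      (least-degree (P * h - g * T ∷ g * P ∷ []) gP≢0 λ n → ∣-resp
        (trans (lemma P (approx x₀ n) (approx X n) T g h)
          (cong₂ (value (approx X n)) (sym p^N0) (sym p^2N)))
        (∣n⇒∣m*n (P * P) (∣m∣n⇒∣m-n (∣n⇒∣m*n P (gx+h≈0 n)) (∣n⇒∣m*n g (x₀≈ n)))))
      λ { (s≤s ()) }
      where
      value : ℤ → ℤ → ℤ → ℤ
      value x r s = 1ℤ * (s * (P * h - g * T) + 1ℤ * (x * (r * (g * P) + 1ℤ * (x * 0ℤ)))) - s * 0ℤ
      P≢0 : P ≢ 0ℤ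
      P≢0 eq = ℕ.≢-nonZero⁻¹ (p ℕ.^ N) {{ℕ.m^n≢0 p N}} (ℤ.+-injective eq)
      gP≢0 : g * P ≢ 0ℤ
      gP≢0 eq = [ g≢0 , P≢0 ]′ (ℤ.i*j≡0⇒i≡0∨j≡0 g eq)
      lemma : ∀ r x y t g h → r * r * (r * (g * x + h) - g * (r * x - (y + - t)))
        ≡ 1ℤ * (r * (r * 1ℤ) * (r * h - g * t) + 1ℤ * (y * (r * 1ℤ * (g * r) + 1ℤ * (y * 0ℤ))))
          - r * (r * 1ℤ) * 0ℤ
      lemma = solve-∀

    minimal₀ : ∃[ a ] ∃[ b ] ∃[ c ] Quadratic x₀ a b c
    minimal₀ = primitive-part {x₀}
      {a * P * P} {+ 2 * a * T * P + b * P * P} {a * (T * T) + b * P * T + c * (P * P)}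
      0<aPP
      (λ n → ∣-resp (lemma P (approx x₀ n) (approx X n) T a b c)
        (∣m∣n⇒∣m+n (X-root n)
          -- The cofactor of (P x₀ + T) - X in the difference of the values of aY² + bPY + cP² at
          -- these two points.
          (∣m⇒∣m*n (a * (P * approx x₀ n + T + approx X n) + b * P) (x₀≈ n))))
      p∣x₀ irrational
      where
      instance
        P-positive : ℤ.Positive P
        P-positive = ℤ.positive (ℤ.+<+ (ℕ.m^n>0 p N))
      0<aPP : 0ℤ ℤ.< a * P * P
      0<aPP = ℤ.*-monoʳ-<-pos P (ℤ.*-monoʳ-<-pos P leading-positive)
      lemma : ∀ r x y t a b c →
        a * (y * y) + b * r * y + c * (r * r) + (r * x - (y + - t)) * (a * (r * x + t + y) + b * r)
        ≡ a * r * r * (x * x) + (+ 2 * a * t * r + b * r * r) * x + (a * (t * t) + b * r * t + c * (r * r))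
      lemma = solve-∀

theorem7p1 : ∀ (p : ℕ) (p-prime : Prime p) →
    let open Padic p p-prime in
    ∀ (α : ℚₚ) → IsQuadratic α →
    ∀ (alg : Algorithm) → HasEventuallyPeriodicExpansion alg α
theorem7p1 p p-prime α α-quadratic = eventually-periodic α (proj₁ fractional) (proj₂ fractional)
  where
  open Expansion p p-prime
  fractional = fractional-part α α-quadratic
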